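{- Let $N>0$ be an integer and $z$ a nonzero complex number (or indeterminate). Let $X,Y,Z$ be formal variables and let $\alpha,\beta$ satisfy $\alpha+\beta=X+Y$, $\alpha\beta=Z$. Then, as formal power series in $X,Y,Z$, \[ \Phi_0^{(N)}(X,Y,Z;z)=\frac{1}{Z-XY} \left\{{}_{2}F_{1}^{(N)}\left(\begin{matrix}\alpha-X,\beta-X\\ 1-X\end{matrix};z\right)-1\right\}, \] where the right-hand side is understood as follows: each term with $m\ge1$ of ${}_{2}F_{1}^{(N)}$ contains the factor $(\alpha-X)(\beta-X)=Z-XY$, so the division is exact, the result is symmetric in $\alpha,\beta$ and hence expressible in $X,Y,Z$, and $1/(1-X)_m$ is expanded as a power series in $X$.
   Context: $(x)_m=x(x+1)\cdots(x+m-1)$ is the rising factorial, $(x)_0=1$. For integers $N>0$, define \[ {}_{2}F_{1}^{(N)}\left(\begin{matrix}a,b\\ c\end{matrix};z\right)=\sum_{m=0}^{N-1}\frac{(a)_m(b)_m}{(c)_m\, m!}\,\frac{(N-m)_m}{(Nz^{ -1}-m)_m}. \] For ${\boldsymbol{k}}=(k_1,\ldots,k_r)\in\mathbb{Z}_{>0}^r$ define the truncated multiple polylogarithm \[ \mathrm{Li}_{\boldsymbol{k}}^{(N)}(z)=\sum_{0<m_1<\cdots<m_r<N}\frac{1}{m_1^{k_1}\cdots m_r^{k_r}}\frac{(N-m_r)_{m_r}}{(Nz^{ -1}-m_r)_{m_r}}. \] For integers $k,r,h>0$ let $I_0(k,r,h)$ be the set of $(k_1,\ldots,k_r)\in\mathbb{Z}_{>0}^r$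 with $k_r>1$, $k_1+\cdots+k_r=k$ and $\#\{i\mid k_i>1\}=h$ (a finite set). Put $G_0^{(N)}(k,r,h;z)=\sum_{{\boldsymbol{k}}\in I_0(k,r,h)}\mathrm{Li}^{(N)}_{\boldsymbol{k}}(z)$ and \[ \Phi_0^{(N)}(X,Y,Z;z)=\sum_{k,r,h>0}G^{(N)}_0(k,r,h;z)\,X^{k-r-h}Y^{r-h}Z^{h-1}. \] -}

module Defs where

open import Level using (Level; _⊔_)
open import Algebra.Bundles using (CommutativeRing; Semiring)
open import Algebra.Definitions using (Invertible)
open import Algebra.Apartness.Bundles using (HeytingField; HeytingCommutativeRing)
open import Algebra.Morphism.Structures using (IsRingHomomorphism; IsRingMonomorphism)
import Algebra.Definitions.RawSemiring as RawSemiringDefs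
import Algebra.Properties.Ring as RingProperties
import Algebra.Properties.CommutativeSemigroup as CommutativeSemigroupProperties
import Algebra.Apartness.Properties.HeytingCommutativeRing as HeytingProperties
import Relation.Binary.Reasoning.Setoid as SetoidReasoning
open import Data.Nat.Base as ℕ using (ℕ; zero; suc; NonZero; _!)
import Data.Nat.Properties as ℕₚ
open import Data.Fin.Base as Fin using (Fin; toℕ)
import Data.Fin.Properties as Finₚ
open import Data.List.Base as List using (List; []; _∷_; allFin; applyUpTo; cartesianProductWith; filter)
open import Data.Vec.Base as Vec using (Vec; []; _∷_; last; count)
open import Data.Vec.Relation.Unary.Linked using (linked?)
open import Data.Product.Base as Prod using (_,_; proj₁)
open import Relation.Binary.PropositionalEquality.Core using (_≡_)
open import Relation.Nullary.Decidable.Core using (_×-dec_)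
open import Relation.Unary using (Decidable)

private
  variable
    a ℓ b ℓ′ c ℓ₁ ℓ₂ s ℓₛ : Level

module RingNotions (A : CommutativeRing a ℓ) where
  open CommutativeRing A
  open RawSemiringDefs (Semiring.rawSemiring semiring) public using (_×_; _^_)
  private
    open module SR = SetoidReasoning setoid
    module *CS = CommutativeSemigroupProperties *-commutativeSemigroup

  fromℕ : ℕ → Carrier
  fromℕ n = n × 1#

  IsUnit : Carrier → Set (a ⊔ ℓ)
  IsUnit = Invertible _≈_ 1# _*_

  recip : ∀ {x} → IsUnit x → Carrier
  recip = proj₁

  rising : Carrier → ℕ → Carrier
  rising x zero    = 1#
  rising x (suc m) = rising x m * (x + fromℕ m)

  ∑ : ∀ {i} {I : Set i} → List I → (I → Carrier) → Carrier
  ∑ []       f = 0#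
  ∑ (i ∷ is) f = f i + ∑ is f

  unit : ∀ {x} y → x * y ≈ 1# → IsUnit x
  unit {x} y xy≈1 = y , trans (*-comm y x) xy≈1 , xy≈1

  unit-resp-≈ : ∀ {x y} → x ≈ y → IsUnit x → IsUnit y
  unit-resp-≈ x≈y (u , _ , xu≈1) = unit u (trans (*-congʳ (sym x≈y)) xu≈1)

  unit-1 : IsUnit 1#
  unit-1 = unit 1# (*-identityˡ 1#)

  unit-* : ∀ {x y} → IsUnit x → IsUnit y → IsUnit (x * y)
  unit-* {x} {y} (u , _ , xu≈1) (v , _ , yv≈1) = unit (u * v) (begin
    (x * y) * (u * v) ≈⟨ *CS.interchange x y u v ⟩
    (x * u) * (y * v) ≈⟨ *-cong xu≈1 yv≈1 ⟩
    1# * 1#           ≈⟨ *-identityˡ 1# ⟩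
    1#                ∎)

  unit-rising : ∀ {x} → (∀ j → IsUnit (x + fromℕ j)) → ∀ m → IsUnit (rising x m)
  unit-rising factor zero    = unit-1
  unit-rising factor (suc m) = unit-* (unit-rising factor m) (factor m)

IsHom : (A : CommutativeRing a ℓ) (B : CommutativeRing b ℓ′) →
        (CommutativeRing.Carrier A → CommutativeRing.Carrier B) → Set (a ⊔ ℓ ⊔ ℓ′)
IsHom A B = IsRingHomomorphism (CommutativeRing.rawRing A) (CommutativeRing.rawRing B)

IsMono : (A : CommutativeRing a ℓ) (B : CommutativeRing b ℓ′) →
         (CommutativeRing.Carrier A → CommutativeRing.Carrier B) → Set (a ⊔ ℓ ⊔ ℓ′)
IsMono A B = IsRingMonomorphism (CommutativeRing.rawRing A) (CommutativeRing.rawRing B)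

module HomProperties {A : CommutativeRing a ℓ} {B : CommutativeRing b ℓ′}
                     {φ : CommutativeRing.Carrier A → CommutativeRing.Carrier B}
                     (φ-hom : IsHom A B φ) where
  private
    module A where
      open CommutativeRing A public
      open RingNotions A public
    module B where
      open CommutativeRing B public
      open RingNotions B public
  open IsRingHomomorphism φ-hom

  fromℕ-homo : ∀ n → φ (A.fromℕ n) B.≈ B.fromℕ n
  fromℕ-homo zero    = 0#-homo
  fromℕ-homo (suc n) = B.trans (+-homo A.1# (A.fromℕ n)) (B.+-cong 1#-homo (fromℕ-homo n))

  unit-homo : ∀ {x} → A.IsUnit x → B.IsUnit (φ x)
  unit-homo {x} (u , _ , xu≈1) =
    B.unit (φ u) (B.trans (B.sym (*-homo x u)) (B.trans (⟦⟧-cong xu≈1) 1#-homo))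

  unit-fromℕ : ∀ n → A.IsUnit (A.fromℕ n) → B.IsUnit (B.fromℕ n)
  unit-fromℕ n un = B.unit-resp-≈ (fromℕ-homo n) (unit-homo un)

module PowerSeries (A : CommutativeRing a ℓ) where
  open CommutativeRing A
  open RingNotions A
  private
    open module SR = SetoidReasoning setoid
    open module RP = RingProperties ring
    module +CS = CommutativeSemigroupProperties +-commutativeSemigroup

  Series : Set a
  Series = ℕ → Carrier

  infix 4 _≋_
  _≋_ : Series → Series → Set ℓ
  f ≋ g = ∀ n → f n ≈ g n

  const : Carrier → Series
  const x zero    = x
  const x (suc n) = 0#

  t : Series
  t zero          = 0#
  t (suc zero)    = 1#
  t (suc (suc n)) = 0#

  tail : Series → Series
  tail f n = f (suc n)

  infixl 6 _⊕_
  _⊕_ : Series → Series → Series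
  (f ⊕ g) n = f n + g n

  ⊖_ : Series → Series
  (⊖ f) n = - f n

  -- (f ⊛ g) n = f 0 * g n + f 1 * g (n - 1) + ⋯ + f n * g 0
  infixl 7 _⊛_
  _⊛_ : Series → Series → Series
  (f ⊛ g) zero    = f 0 * g 0
  (f ⊛ g) (suc n) = f 0 * g (suc n) + (tail f ⊛ g) n

  private
    ⊛-cong : ∀ {f f′ g g′} → f ≋ f′ → g ≋ g′ → f ⊛ g ≋ f′ ⊛ g′
    ⊛-cong p q zero    = *-cong (p 0) (q 0)
    ⊛-cong p q (suc n) = +-cong (*-cong (p 0) (q (suc n))) (⊛-cong (λ k → p (suc k)) q n)

    ⊛-distribʳ : ∀ h f g → (f ⊕ g) ⊛ h ≋ (f ⊛ h) ⊕ (g ⊛ h)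
    ⊛-distribʳ h f g zero    = distribʳ (h 0) (f 0) (g 0)
    ⊛-distribʳ h f g (suc n) = begin
      (f 0 + g 0) * h (suc n) + ((tail f ⊕ tail g) ⊛ h) n
        ≈⟨ +-cong (distribʳ (h (suc n)) (f 0) (g 0)) (⊛-distribʳ h (tail f) (tail g) n) ⟩
      (f 0 * h (suc n) + g 0 * h (suc n)) + ((tail f ⊛ h) n + (tail g ⊛ h) n)
        ≈⟨ +CS.interchange _ _ _ _ ⟩
      (f ⊛ h) (suc n) + (g ⊛ h) (suc n) ∎

    ⊛-suc : ∀ f g n → (f ⊛ g) (suc n) ≈ (f ⊛ tail g) n + f (suc n) * g 0
    ⊛-suc f g zero    = refl
    ⊛-suc f g (suc n) = trans (+-congˡ (⊛-suc (tail f) g n)) (sym (+-assoc _ _ _))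

    ⊛-comm : ∀ f g → f ⊛ g ≋ g ⊛ f
    ⊛-comm f g zero    = *-comm (f 0) (g 0)
    ⊛-comm f g (suc n) = begin
      f 0 * g (suc n) + (tail f ⊛ g) n ≈⟨ +-cong (*-comm _ _) (⊛-comm (tail f) g n) ⟩
      g (suc n) * f 0 + (g ⊛ tail f) n ≈⟨ +-comm _ _ ⟩
      (g ⊛ tail f) n + g (suc n) * f 0 ≈⟨ sym (⊛-suc g f n) ⟩
      (g ⊛ f) (suc n)                  ∎

    ⊛-scale : ∀ x f g n → ((λ k → x * f k) ⊛ g) n ≈ x * (f ⊛ g) n
    ⊛-scale x f g zero    = *-assoc x (f 0) (g 0)
    ⊛-scale x f g (suc n) = begin
      x * f 0 * g (suc n) + ((λ k → x * f (suc k)) ⊛ g) n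
        ≈⟨ +-cong (*-assoc x (f 0) _) (⊛-scale x (tail f) g n) ⟩
      x * (f 0 * g (suc n)) + x * (tail f ⊛ g) n
        ≈⟨ sym (distribˡ x _ _) ⟩
      x * (f ⊛ g) (suc n) ∎

    ⊛-assoc : ∀ f g h → (f ⊛ g) ⊛ h ≋ f ⊛ (g ⊛ h)
    ⊛-assoc f g h zero    = *-assoc (f 0) (g 0) (h 0)
    ⊛-assoc f g h (suc n) = begin
      f 0 * g 0 * h (suc n) + (((λ k → f 0 * tail g k) ⊕ (tail f ⊛ g)) ⊛ h) n
        ≈⟨ +-cong (*-assoc _ _ _) (⊛-distribʳ h _ _ n) ⟩
      f 0 * (g 0 * h (suc n)) + (((λ k → f 0 * tail g k) ⊛ h) n + ((tail f ⊛ g) ⊛ h) n)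
        ≈⟨ +-congˡ (+-cong (⊛-scale (f 0) (tail g) h n) (⊛-assoc (tail f) g h n)) ⟩
      f 0 * (g 0 * h (suc n)) + (f 0 * (tail g ⊛ h) n + (tail f ⊛ (g ⊛ h)) n)
        ≈⟨ sym (+-assoc _ _ _) ⟩
      f 0 * (g 0 * h (suc n)) + f 0 * (tail g ⊛ h) n + (tail f ⊛ (g ⊛ h)) n
        ≈⟨ +-congʳ (sym (distribˡ (f 0) _ _)) ⟩
      (f ⊛ (g ⊛ h)) (suc n) ∎

    ⊛-zeroˡ : ∀ g n → ((λ _ → 0#) ⊛ g) n ≈ 0#
    ⊛-zeroˡ g zero    = zeroˡ (g 0)
    ⊛-zeroˡ g (suc n) = trans (+-cong (zeroˡ _) (⊛-zeroˡ g n)) (+-identityˡ 0#)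

    const-⊛ : ∀ x g n → (const x ⊛ g) n ≈ x * g n
    const-⊛ x g zero    = refl
    const-⊛ x g (suc n) = trans (+-congˡ (⊛-zeroˡ g n)) (+-identityʳ _)

    ⊛-identityˡ : ∀ g → const 1# ⊛ g ≋ g
    ⊛-identityˡ g n = trans (const-⊛ 1# g n) (*-identityˡ (g n))

  seriesRing : CommutativeRing a ℓ
  seriesRing = record
    { Carrier = Series
    ; _≈_ = _≋_
    ; _+_ = _⊕_
    ; _*_ = _⊛_
    ; -_  = ⊖_
    ; 0#  = λ _ → 0#
    ; 1#  = const 1#
    ; isCommutativeRing = record
      { isRing = record
        { +-isAbelianGroup = record
          { isGroup = record
            { isMonoid = record
              { isSemigroup = record
                { isMagma = record
                  { isEquivalence = record
                    { refl  = λ _ → refl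
                    ; sym   = λ p n → sym (p n)
                    ; trans = λ p q n → trans (p n) (q n)
                    }
                  ; ∙-cong = λ p q n → +-cong (p n) (q n)
                  }
                ; assoc = λ f g h n → +-assoc (f n) (g n) (h n)
                }
              ; identity = (λ f n → +-identityˡ (f n)) , (λ f n → +-identityʳ (f n))
              }
            ; inverse = (λ f n → -‿inverseˡ (f n)) , (λ f n → -‿inverseʳ (f n))
            ; ⁻¹-cong = λ p n → -‿cong (p n)
            }
          ; comm = λ f g n → +-comm (f n) (g n)
          }
        ; *-cong = ⊛-cong
        ; *-assoc = ⊛-assoc
        ; *-identity = ⊛-identityˡ
                     , (λ f n → trans (⊛-comm f (const 1#) n) (⊛-identityˡ f n))
        ; distrib = (λ f g h n → trans (⊛-comm f (g ⊕ h) n)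
                                   (trans (⊛-distribʳ f g h n)
                                     (+-cong (⊛-comm g f n) (⊛-comm h f n))))
                  , ⊛-distribʳ
        }
      ; *-comm = ⊛-comm
      }
    }

  const-isHom : IsHom A seriesRing const
  const-isHom = record
    { isSemiringHomomorphism = record
      { isNearSemiringHomomorphism = record
        { +-isMonoidHomomorphism = record
          { isMagmaHomomorphism = record
            { isRelHomomorphism = record
              { cong = λ { p zero → p ; p (suc n) → refl } }
            ; homo = λ { x y zero → refl ; x y (suc n) → sym (+-identityˡ 0#) }
            }
          ; ε-homo = λ { zero → refl ; (suc n) → refl }
          }
        ; *-homo = λ x y n → sym (trans (const-⊛ x (const y) n) (*-const x y n))
        }
      ; 1#-homo = λ _ → refl
      }
    ; -‿homo = λ { x zero → refl ; x (suc n) → sym -0#≈0# }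
    }
    where
    *-const : ∀ x y n → x * const y n ≈ const (x * y) n
    *-const x y zero    = refl
    *-const x y (suc n) = zeroʳ x

  -- 1 / (x - t) = 1/x + t/x² + t²/x³ + ⋯
  unit-const-t : ∀ {x} → IsUnit x → RingNotions.IsUnit seriesRing (const x ⊕ ⊖ t)
  unit-const-t {x} (u , _ , xu≈1) = RingNotions.unit seriesRing g inverse
    where
    g : Series
    g n = u ^ suc n

    x-t : Series
    x-t = const x ⊕ ⊖ t

    x-0 : x + - 0# ≈ x
    x-0 = trans (+-congˡ -0#≈0#) (+-identityʳ x)

    tail-x-t : tail x-t ≋ const (- 1#)
    tail-x-t zero    = +-identityˡ (- 1#)
    tail-x-t (suc n) = trans (+-identityˡ _) -0#≈0#

    x*g : ∀ n → x * (u * u ^ n) ≈ u ^ n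
    x*g n = trans (sym (*-assoc x u _)) (trans (*-congʳ xu≈1) (*-identityˡ _))

    inverse : x-t ⊛ g ≋ const 1#
    inverse zero    = trans (*-congʳ x-0) (x*g 0)
    inverse (suc n) = begin
      (x + - 0#) * g (suc n) + (tail x-t ⊛ g) n
        ≈⟨ +-cong (*-congʳ x-0) (⊛-cong {g = g} tail-x-t (λ _ → refl) n) ⟩
      x * g (suc n) + (const (- 1#) ⊛ g) n
        ≈⟨ +-cong (x*g (suc n)) (trans (const-⊛ (- 1#) g n) (-1*x≈-x (g n))) ⟩
      g n + - g n
        ≈⟨ -‿inverseʳ (g n) ⟩
      0# ∎

open PowerSeries using (seriesRing; const; const-isHom; t)

-- K⟦X,Y,Z⟧ is realised as K⟦Z⟧⟦Y⟧⟦X⟧: the coefficient of XᵖYᵠZˢ in f is f p q s.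
module _ (K : CommutativeRing a ℓ) where
  private
    K⟦Z⟧  = seriesRing K
    K⟦Y,Z⟧ = seriesRing K⟦Z⟧

  K⟦X,Y,Z⟧ : CommutativeRing a ℓ
  K⟦X,Y,Z⟧ = seriesRing K⟦Y,Z⟧

  𝐗 𝐘 𝐙 : CommutativeRing.Carrier K⟦X,Y,Z⟧
  𝐗 = t K⟦Y,Z⟧
  𝐘 = const K⟦Y,Z⟧ (t K⟦Z⟧)
  𝐙 = const K⟦Y,Z⟧ (const K⟦Z⟧ (t K))

  scalar : CommutativeRing.Carrier K → CommutativeRing.Carrier K⟦X,Y,Z⟧
  scalar x = const K⟦Y,Z⟧ (const K⟦Z⟧ (const K x))

  private
    module K = RingNotions K
    module R where
      open CommutativeRing K⟦X,Y,Z⟧ public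
      open RingNotions K⟦X,Y,Z⟧ public
    module hom₁ = HomProperties {A = K} {B = K⟦Z⟧} (const-isHom K)
    module hom₂ = HomProperties {A = K⟦Z⟧} {B = K⟦Y,Z⟧} (const-isHom K⟦Z⟧)
    module hom₃ = HomProperties {A = K⟦Y,Z⟧} {B = K⟦X,Y,Z⟧} (const-isHom K⟦Y,Z⟧)
    module K⟦Y,Z⟧ = RingNotions K⟦Y,Z⟧

  unit-1-X+j : (∀ n → K.IsUnit (K.fromℕ (suc n))) →
               ∀ j → R.IsUnit ((R.1# R.- 𝐗) R.+ R.fromℕ j)
  unit-1-X+j unitℕ j = R.unit-resp-≈ eq
    (PowerSeries.unit-const-t K⟦Y,Z⟧ (hom₂.unit-fromℕ (suc j) (hom₁.unit-fromℕ (suc j) (unitℕ j))))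
    where
    open SetoidReasoning R.setoid
    module +CS = CommutativeSemigroupProperties R.+-commutativeSemigroup
    eq : const K⟦Y,Z⟧ (K⟦Y,Z⟧.fromℕ (suc j)) R.- 𝐗 R.≈ (R.1# R.- 𝐗) R.+ R.fromℕ j
    eq = begin
      const K⟦Y,Z⟧ (K⟦Y,Z⟧.fromℕ (suc j)) R.- 𝐗 ≈⟨ R.+-congʳ (hom₃.fromℕ-homo (suc j)) ⟩
      (R.1# R.+ R.fromℕ j) R.- 𝐗                 ≈⟨ +CS.xy∙z≈xz∙y R.1# (R.fromℕ j) (R.- 𝐗) ⟩
      (R.1# R.- 𝐗) R.+ R.fromℕ j                 ∎

  unit-scalar-fromℕ : ∀ n → K.IsUnit (K.fromℕ n) → R.IsUnit (R.fromℕ n)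
  unit-scalar-fromℕ n un = hom₃.unit-fromℕ n (hom₂.unit-fromℕ n (hom₁.unit-fromℕ n un))

tuples : ∀ {i} {I : Set i} → List I → (r : ℕ) → List (Vec I r)
tuples is zero    = [] ∷ []
tuples is (suc r) = cartesianProductWith _∷_ is (tuples is r)

IsI₀ : (k r h : ℕ) → Vec ℕ (suc r) → Set
IsI₀ k r h ks = (1 ℕ.< last ks) Prod.× (Vec.sum ks ≡ k) Prod.× (count (1 ℕₚ.<?_) ks ≡ h)

isI₀? : ∀ k r h → Decidable (IsI₀ k r h)
isI₀? k r h ks = (1 ℕₚ.<? last ks) ×-dec (Vec.sum ks ℕₚ.≟ k) ×-dec (count (1 ℕₚ.<?_) ks ℕₚ.≟ h)

-- I₀ k r h enumerates I₀(k, r + 1, h).  Entries of a tuple of positive integers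
-- with sum k are at most k, so it suffices to select from {1,…,k}^(r+1).
I₀ : (k r h : ℕ) → List (Vec ℕ (suc r))
I₀ k r h = filter (isI₀? k r h) (tuples (applyUpTo suc k) (suc r))

increasing : (n r : ℕ) → List (Vec (Fin n) r)
increasing n r = filter (linked? Finₚ._<?_) (tuples (allFin n) r)

fieldRing : HeytingField c ℓ₁ ℓ₂ → CommutativeRing c ℓ₁
fieldRing K = HeytingCommutativeRing.commutativeRing (HeytingField.heytingCommutativeRing K)

module FieldNotions (K : HeytingField c ℓ₁ ℓ₂) where
  open HeytingField K
  open RingNotions (fieldRing K) public

  CharZero : Set ℓ₂
  CharZero = ∀ n → fromℕ (suc n) # 0#

  #0⇒unit : ∀ {x} → x # 0# → IsUnit x
  #0⇒unit {x} x#0 = unit-resp-≈ (HeytingProperties.x-0≈x heytingCommutativeRing x) (#⇒invertible x#0)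

  infix 9 _⁻¹[_]
  _⁻¹[_] : ∀ x → x # 0# → Carrier
  x ⁻¹[ x#0 ] = recip (#0⇒unit x#0)

  -- (N z⁻¹ - m)_m
  denominator : (N : ℕ) (z : Carrier) → z # 0# → ℕ → Carrier
  denominator N z z#0 m = rising (fromℕ N * z ⁻¹[ z#0 ] - fromℕ m) m

  DenominatorsNonzero : (N : ℕ) (z : Carrier) → z # 0# → Set ℓ₂
  DenominatorsNonzero N z z#0 = (m : Fin N) → denominator N z z#0 (toℕ m) # 0#

-- The truncation level N > 0 is suc n.
module Truncated
  (K : HeytingField c ℓ₁ ℓ₂) (char0 : FieldNotions.CharZero K) (n : ℕ)
  (z : HeytingField.Carrier K) (z#0 : HeytingField._#_ K z (HeytingField.0# K))
  (den#0 : FieldNotions.DenominatorsNonzero K (suc n) z z#0)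
  where

  open HeytingField K
  open FieldNotions K
  private
    N : ℕ
    N = suc n

  -- (N - m)_m / (N z⁻¹ - m)_m
  weight : Fin N → Carrier
  weight m = rising (fromℕ N - fromℕ (toℕ m)) (toℕ m)
           * denominator N z z#0 (toℕ m) ⁻¹[ den#0 m ]

  -- A summation index 0 < m < N is written m = suc j with j : Fin n.
  Li : ∀ {r} → Vec ℕ (suc r) → Carrier
  Li {r} ks = ∑ (increasing n (suc r)) λ js →
    Vec.foldr′ _*_ 1# (Vec.zipWith (λ j k → (fromℕ (suc (toℕ j)) ⁻¹[ char0 (toℕ j) ]) ^ k) js ks)
    * weight (Fin.suc (last js))

  -- As with I₀, the argument r stands for depth r + 1.
  G₀ : (k r h : ℕ) → Carrier
  G₀ k r h = ∑ (I₀ k r h) Li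

  -- The triple (k, r, h) contributing to XᵖYᵠZˢ is determined by
  -- h - 1 = s, r - h = q, k - r - h = p.  Triples giving a negative exponent
  -- have I₀(k, r, h) empty, since h ≤ r and k ≥ r + h on I₀(k, r, h).
  Φ₀ : CommutativeRing.Carrier (K⟦X,Y,Z⟧ (fieldRing K))
  Φ₀ p q s = G₀ (r ℕ.+ h ℕ.+ p) (ℕ.pred r) h
    where
    h = suc s
    r = h ℕ.+ q

  -- The upper and lower parameters live in a K-algebra S with structure map φ,
  -- while z stays in K.
  module _ (S : CommutativeRing s ℓₛ) (φ : Carrier → CommutativeRing.Carrier S) where
    private
      module S where
        open CommutativeRing S public
        open RingNotions S public

    ₂F₁ : (α β γ : S.Carrier) →
          ((m : Fin N) → S.IsUnit (S.rising γ (toℕ m) S.* S.fromℕ (toℕ m !))) →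
          S.Carrier
    ₂F₁ α β γ den-unit = S.∑ (allFin N) λ m →
      S.rising α (toℕ m) S.* S.rising β (toℕ m) S.* S.recip (den-unit m) S.* φ (weight m)

module Extension
  (K : HeytingField c ℓ₁ ℓ₂) (S : CommutativeRing s ℓₛ)
  (ι : CommutativeRing.Carrier (K⟦X,Y,Z⟧ (fieldRing K)) → CommutativeRing.Carrier S)
  (ι-mono : IsMono (K⟦X,Y,Z⟧ (fieldRing K)) S ι)
  where

  private
    module K = FieldNotions K
    module R where
      open CommutativeRing (K⟦X,Y,Z⟧ (fieldRing K)) public
      open RingNotions (K⟦X,Y,Z⟧ (fieldRing K)) public
    module S where
      open CommutativeRing S public
      open RingNotions S public
    module ι = IsRingMonomorphism ι-mono
    module hom = HomProperties {A = K⟦X,Y,Z⟧ (fieldRing K)} {B = S} ι.isRingHomomorphism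

  X : S.Carrier
  X = ι (𝐗 (fieldRing K))

  unit-fromℕ : K.CharZero → ∀ k → .{{NonZero k}} → S.IsUnit (S.fromℕ k)
  unit-fromℕ char0 (suc k) =
    hom.unit-fromℕ (suc k) (unit-scalar-fromℕ (fieldRing K) (suc k) (K.#0⇒unit (char0 k)))

  unit-denominator : K.CharZero → ∀ m → S.IsUnit (S.rising (S.1# S.- X) m S.* S.fromℕ (m !))
  unit-denominator char0 m = S.unit-* (S.unit-rising factor m) (unit-fromℕ char0 (m !) {{ℕₚ._!≢0 m}})
    where
    open SetoidReasoning S.setoid
    𝟙-𝐗 : R.Carrier
    𝟙-𝐗 = R.1# R.- 𝐗 (fieldRing K)
    eq : ∀ j → ι (𝟙-𝐗 R.+ R.fromℕ j) S.≈ (S.1# S.- X) S.+ S.fromℕ j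
    eq j = begin
      ι (𝟙-𝐗 R.+ R.fromℕ j)              ≈⟨ ι.+-homo _ _ ⟩
      ι 𝟙-𝐗 S.+ ι (R.fromℕ j)            ≈⟨ S.+-cong (ι.+-homo _ _) (hom.fromℕ-homo j) ⟩
      (ι R.1# S.+ ι (R.- 𝐗 (fieldRing K))) S.+ S.fromℕ j
        ≈⟨ S.+-congʳ (S.+-cong ι.1#-homo (ι.-‿homo _)) ⟩
      (S.1# S.- X) S.+ S.fromℕ j          ∎
    factor : ∀ j → S.IsUnit ((S.1# S.- X) S.+ S.fromℕ j)
    factor j = S.unit-resp-≈ (eq j)
      (hom.unit-homo (unit-1-X+j (fieldRing K) (λ k → K.#0⇒unit (char0 k)) j))

  -- q = P / D: the numerator P, a priori in the extension S, is exactly divisible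
  -- by D with quotient the power series q, and q is the only such power series.
  record IsExactQuotient (q : R.Carrier) (P : S.Carrier) (D : R.Carrier) : Set (c ⊔ ℓ₁ ⊔ ℓₛ) where
    field
      exact  : ι D S.* ι q S.≈ P
      unique : ∀ q′ → ι D S.* ι q′ S.≈ P → q′ R.≈ q

{-# OPTIONS --safe #-}

-- The identity α + β = X + Y, αβ = Z gives (α - X + j)(β - X + j) = Z + (j - X)(j + Y), which is
-- Z - XY for j = 0 and j (j - X) (1 + Y/j + Z/(j (j - X))) for j > 0.  Hence the term of index m > 0
-- of the hypergeometric sum, divided by Z - XY, is
--   1/(m (m - X)) · ∏_{0<j<m} (1 + Y/j + Z/(j (j - X)))
-- times its weight.  Expanding the product chooses the indices m₁ < ⋯ < m_r = m of a multiple
-- polylogarithm: Y/j records an exponent 1, and Z/(j (j - X)) = Σ_i XⁱZ/j^(2+i) an exponent > 1,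
-- the last exponent being forced to be > 1 and its factor Z being dropped.  This is Φ₀.
-- Uniqueness of the quotient holds because Z - XY is not a zero divisor: comparing coefficients of
-- XᵖYᵠZˢ⁺¹ expresses the (p, q, s) coefficient of f by that of (Z - XY) f and the
-- (p - 1, q - 1, s + 1) coefficient of f.
module Submission where

open import Defs
open import Algebra.Apartness.Bundles using (HeytingField)
open import Algebra.Bundles using (CommutativeRing)
import Algebra.Morphism.Construct.Composition as Composition
open import Algebra.Morphism.Structures using (IsRingHomomorphism; IsRingMonomorphism)
import Algebra.Properties.CommutativeSemigroup as CommutativeSemigroupProperties
import Algebra.Properties.Ring as RingProperties
import Algebra.Properties.Semiring.Mult as SemiringMult
import Algebra.Solver.Ring.NaturalCoefficients.Default
open import Data.Bool.Base using (Bool; true; false; if_then_else_; _∧_)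
import Data.Bool.Properties as Boolₚ
open import Data.Fin.Base using (Fin; zero; suc; toℕ)
import Data.Fin.Properties as Finₚ
open import Data.List.Base as List using (List; []; _∷_; _++_; allFin; applyUpTo; upTo; cartesianProductWith; filter; tabulate)
open import Data.List.Relation.Unary.All using (All; []; _∷_)
import Data.List.Relation.Unary.All.Properties as Allₚ
open import Data.Nat.Base as ℕ using (ℕ; zero; suc; _∸_; _≡ᵇ_; _≤ᵇ_; _!; s≤s; z≤n)
import Data.Nat.Properties as ℕₚ
open import Data.Product.Base using (_,_; proj₁; proj₂)
open import Data.Vec.Base as Vec using (Vec; []; _∷_; last; count)
import Data.Vec.Properties as Vecₚ
open import Data.Vec.Relation.Unary.All using ([]; _∷_) renaming (All to Allᵥ)
open import Data.Vec.Relation.Unary.Linked using (linked?)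
open import Function.Base using (_∘_; id)
open import Level using (Level)
open import Relation.Binary.PropositionalEquality as ≡ using (_≡_)
import Relation.Binary.Reasoning.Setoid as SetoidReasoning
open import Relation.Nullary.Decidable using (does; yes; no; dec-true; dec-false)
open import Relation.Unary using (Pred; Decidable)

private
  variable
    a ℓ i p : Level
    I J : Set i

  module ℕ+CS = CommutativeSemigroupProperties ℕₚ.+-commutativeSemigroup

-- Finite sums with Boolean guards

module FiniteSums (A : CommutativeRing a ℓ) where
  open CommutativeRing A hiding (zero)
  open RingNotions A
  open SetoidReasoning setoid
  private
    module +CS = CommutativeSemigroupProperties +-commutativeSemigroup

  infixr 5 _▸_
  -- Iverson bracket. It binds more loosely than `+` and `*`, so in `b ▸ x * y` the whole product is
  -- guarded.
  _▸_ : Bool → Carrier → Carrier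
  b ▸ x = if b then x else 0#

  ▸-cong : ∀ b {x y} → x ≈ y → b ▸ x ≈ b ▸ y
  ▸-cong true  x≈y = x≈y
  ▸-cong false x≈y = refl

  ▸-0 : ∀ b → b ▸ 0# ≈ 0#
  ▸-0 true  = refl
  ▸-0 false = refl

  ▸-∧ : ∀ b c x → (b ∧ c) ▸ x ≡ b ▸ c ▸ x
  ▸-∧ true  c x = ≡.refl
  ▸-∧ false c x = ≡.refl

  ▸-* : ∀ b x y → b ▸ x * y ≈ x * (b ▸ y)
  ▸-* true  x y = refl
  ▸-* false x y = sym (zeroʳ x)

  ∑-cong : (is : List I) {f g : I → Carrier} → (∀ i → f i ≈ g i) → ∑ is f ≈ ∑ is g
  ∑-cong []       f≈g = refl
  ∑-cong (i ∷ is) f≈g = +-cong (f≈g i) (∑-cong is f≈g)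

  ∑-congAll : {P : Pred I p} {is : List I} {f g : I → Carrier} →
              All P is → (∀ i → P i → f i ≈ g i) → ∑ is f ≈ ∑ is g
  ∑-congAll []         f≈g = refl
  ∑-congAll (pi ∷ pis) f≈g = +-cong (f≈g _ pi) (∑-congAll pis f≈g)

  ∑-zero : (is : List I) → ∑ is (λ _ → 0#) ≈ 0#
  ∑-zero []       = refl
  ∑-zero (i ∷ is) = trans (+-identityˡ _) (∑-zero is)

  ∑-+ : (is : List I) (f g : I → Carrier) → ∑ is (λ i → f i + g i) ≈ ∑ is f + ∑ is g
  ∑-+ []       f g = sym (+-identityˡ 0#)
  ∑-+ (i ∷ is) f g = trans (+-congˡ (∑-+ is f g)) (+CS.interchange _ _ _ _)

  ∑-* : (is : List I) (x : Carrier) (f : I → Carrier) → ∑ is (λ i → x * f i) ≈ x * ∑ is f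
  ∑-* []       x f = sym (zeroʳ x)
  ∑-* (i ∷ is) x f = trans (+-congˡ (∑-* is x f)) (sym (distribˡ x _ _))

  ∑-▸ : (is : List I) (b : Bool) (f : I → Carrier) → ∑ is (λ i → b ▸ f i) ≈ b ▸ ∑ is f
  ∑-▸ is true  f = refl
  ∑-▸ is false f = ∑-zero is

  ∑-++ : (is js : List I) (f : I → Carrier) → ∑ (is ++ js) f ≈ ∑ is f + ∑ js f
  ∑-++ []       js f = sym (+-identityˡ _)
  ∑-++ (i ∷ is) js f = trans (+-congˡ (∑-++ is js f)) (sym (+-assoc _ _ _))

  ∑-map : (h : I → J) (is : List I) (f : J → Carrier) → ∑ (List.map h is) f ≡ ∑ is (f ∘ h)
  ∑-map h []       f = ≡.refl
  ∑-map h (i ∷ is) f = ≡.cong (f (h i) +_) (∑-map h is f)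

  ∑-applyUpTo : (h : ℕ → I) (g : ℕ → ℕ) (b : ℕ) (f : I → Carrier) →
                ∑ (applyUpTo (h ∘ g) b) f ≡ ∑ (applyUpTo g b) (f ∘ h)
  ∑-applyUpTo h g zero    f = ≡.refl
  ∑-applyUpTo h g (suc b) f = ≡.cong (f (h (g 0)) +_) (∑-applyUpTo h (g ∘ suc) b f)

  ∑-tabulate : ∀ {n m} (h : Fin m → I) (g : Fin n → Fin m) (f : I → Carrier) →
               ∑ (tabulate (h ∘ g)) f ≡ ∑ (tabulate g) (f ∘ h)
  ∑-tabulate {n = zero}  h g f = ≡.refl
  ∑-tabulate {n = suc n} h g f = ≡.cong (f (h (g zero)) +_) (∑-tabulate h (g ∘ suc) f)

  ∑-allFin-suc : ∀ n (f : Fin (suc n) → Carrier) →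
                 ∑ (allFin (suc n)) f ≡ f zero + ∑ (allFin n) (f ∘ suc)
  ∑-allFin-suc n f = ≡.cong (f zero +_) (∑-tabulate suc id f)

  ∑-swap : (is : List I) (js : List J) (f : I → J → Carrier) →
           ∑ is (λ i → ∑ js (f i)) ≈ ∑ js (λ j → ∑ is (λ i → f i j))
  ∑-swap []       js f = sym (∑-zero js)
  ∑-swap (i ∷ is) js f = trans (+-congˡ (∑-swap is js f)) (sym (∑-+ js _ _))

  ∑-filter : {P : Pred I p} (P? : Decidable P) (is : List I) (f : I → Carrier) →
             ∑ (filter P? is) f ≈ ∑ is (λ i → does (P? i) ▸ f i)
  ∑-filter P? []       f = refl
  ∑-filter P? (i ∷ is) f with does (P? i)
  ... | true  = +-congˡ (∑-filter P? is f)
  ... | false = trans (∑-filter P? is f) (sym (+-identityˡ _))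

  ∑-cartesianProductWith : ∀ {k} {L : Set k} (h : I → J → L) (is : List I) (js : List J) (f : L → Carrier) →
    ∑ (cartesianProductWith h is js) f ≈ ∑ is (λ i → ∑ js (λ j → f (h i j)))
  ∑-cartesianProductWith h []       js f = refl
  ∑-cartesianProductWith h (i ∷ is) js f = begin
    ∑ (List.map (h i) js ++ cartesianProductWith h is js) f
      ≈⟨ ∑-++ (List.map (h i) js) _ f ⟩
    ∑ (List.map (h i) js) f + ∑ (cartesianProductWith h is js) f
      ≈⟨ +-cong (reflexive (∑-map (h i) js f)) (∑-cartesianProductWith h is js f) ⟩
    ∑ (i ∷ is) (λ i → ∑ js (λ j → f (h i j))) ∎

  ∑-tuples-suc : (is : List I) (r : ℕ) (f : Vec I (suc r) → Carrier) →
                 ∑ (tuples is (suc r)) f ≈ ∑ is (λ i → ∑ (tuples is r) (λ v → f (i ∷ v)))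
  ∑-tuples-suc is r f = ∑-cartesianProductWith _∷_ is (tuples is r) f

  ∑-tuples-congAll : {P : Pred I p} {is : List I} → All P is → ∀ r {f g : Vec I r → Carrier} →
                     (∀ v → Allᵥ P v → f v ≈ g v) → ∑ (tuples is r) f ≈ ∑ (tuples is r) g
  ∑-tuples-congAll             pis zero            f≈g = +-congʳ (f≈g [] [])
  ∑-tuples-congAll {is = is} pis (suc r) {f} {g} f≈g = begin
    ∑ (tuples is (suc r)) f                             ≈⟨ ∑-tuples-suc is r f ⟩
    ∑ is (λ i → ∑ (tuples is r) (λ v → f (i ∷ v)))
      ≈⟨ ∑-congAll pis (λ i pi → ∑-tuples-congAll pis r (λ v pv → f≈g (i ∷ v) (pi ∷ pv))) ⟩
    ∑ is (λ i → ∑ (tuples is r) (λ v → g (i ∷ v)))     ≈⟨ ∑-tuples-suc is r g ⟨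
    ∑ (tuples is (suc r)) g                             ∎

  -- Sums over increasing tuples of indices

  private
    ordered : ∀ {n r} → Vec (Fin n) r → Bool
    ordered v = does (linked? Finₚ._<?_ v)

  -- Strictness rules out `zero` after `suc j`, so every later entry is a successor; removing all
  -- these successors leaves the order tests unchanged by computation.
  ∑-ordered-after-suc : ∀ n r (j : Fin n) (f : Vec (Fin (suc n)) r → Carrier) →
    ∑ (tuples (allFin (suc n)) r) (λ v → ordered (suc j ∷ v) ▸ f v) ≈
    ∑ (tuples (allFin n) r) (λ v → ordered (j ∷ v) ▸ f (Vec.map suc v))
  ∑-ordered-after-suc n zero    j f = refl
  ∑-ordered-after-suc n (suc r) j f = begin
    ∑ (tuples (allFin (suc n)) (suc r)) (λ v → ordered (suc j ∷ v) ▸ f v)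
      ≈⟨ ∑-tuples-suc (allFin (suc n)) r _ ⟩
    ∑ (allFin (suc n)) (λ i → ∑ (tuples (allFin (suc n)) r) (λ v → ordered (suc j ∷ i ∷ v) ▸ f (i ∷ v)))
      ≈⟨ reflexive (∑-allFin-suc n _) ⟩
    ∑ (tuples (allFin (suc n)) r) (λ _ → 0#) +
    ∑ (allFin n) (λ i → ∑ (tuples (allFin (suc n)) r) (λ v → ordered (suc j ∷ suc i ∷ v) ▸ f (suc i ∷ v)))
      ≈⟨ trans (+-congʳ (∑-zero (tuples (allFin (suc n)) r))) (+-identityˡ _) ⟩
    ∑ (allFin n) (λ i → ∑ (tuples (allFin (suc n)) r) (λ v → ordered (suc j ∷ suc i ∷ v) ▸ f (suc i ∷ v)))
      ≈⟨ ∑-cong (allFin n) step ⟩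
    ∑ (allFin n) (λ i → ∑ (tuples (allFin n) r) (λ v → ordered (j ∷ i ∷ v) ▸ f (suc i ∷ Vec.map suc v)))
      ≈⟨ ∑-tuples-suc (allFin n) r _ ⟨
    ∑ (tuples (allFin n) (suc r)) (λ v → ordered (j ∷ v) ▸ f (Vec.map suc v)) ∎
    where
    step : ∀ i → ∑ (tuples (allFin (suc n)) r) (λ v → ordered (suc j ∷ suc i ∷ v) ▸ f (suc i ∷ v)) ≈
                 ∑ (tuples (allFin n) r) (λ v → ordered (j ∷ i ∷ v) ▸ f (suc i ∷ Vec.map suc v))
    step i = begin
      ∑ (tuples (allFin (suc n)) r) (λ v → (j<i ∧ ordered (suc i ∷ v)) ▸ f (suc i ∷ v))
        ≈⟨ ∑-cong (tuples (allFin (suc n)) r) (λ v → reflexive (▸-∧ j<i _ _)) ⟩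
      ∑ (tuples (allFin (suc n)) r) (λ v → j<i ▸ ordered (suc i ∷ v) ▸ f (suc i ∷ v))
        ≈⟨ ∑-▸ (tuples (allFin (suc n)) r) j<i _ ⟩
      j<i ▸ ∑ (tuples (allFin (suc n)) r) (λ v → ordered (suc i ∷ v) ▸ f (suc i ∷ v))
        ≈⟨ ▸-cong j<i (∑-ordered-after-suc n r i (λ v → f (suc i ∷ v))) ⟩
      j<i ▸ ∑ (tuples (allFin n) r) (λ v → ordered (i ∷ v) ▸ f (suc i ∷ Vec.map suc v))
        ≈⟨ ∑-▸ (tuples (allFin n) r) j<i _ ⟨
      ∑ (tuples (allFin n) r) (λ v → j<i ▸ ordered (i ∷ v) ▸ f (suc i ∷ Vec.map suc v))
        ≈⟨ ∑-cong (tuples (allFin n) r) (λ v → reflexive (▸-∧ j<i _ _)) ⟨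
      ∑ (tuples (allFin n) r) (λ v → (j<i ∧ ordered (i ∷ v)) ▸ f (suc i ∷ Vec.map suc v)) ∎
      where
      j<i : Bool
      j<i = does (j Finₚ.<? i)

  ∑-ordered-suc : ∀ n r (f : Vec (Fin (suc n)) (suc r) → Carrier) →
    ∑ (allFin n) (λ i → ∑ (tuples (allFin (suc n)) r) (λ v → ordered (suc i ∷ v) ▸ f (suc i ∷ v))) ≈
    ∑ (increasing n (suc r)) (λ v → f (Vec.map suc v))
  ∑-ordered-suc n r f = begin
    ∑ (allFin n) (λ i → ∑ (tuples (allFin (suc n)) r) (λ v → ordered (suc i ∷ v) ▸ f (suc i ∷ v)))
      ≈⟨ ∑-cong (allFin n) (λ i → ∑-ordered-after-suc n r i (λ v → f (suc i ∷ v))) ⟩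
    ∑ (allFin n) (λ i → ∑ (tuples (allFin n) r) (λ v → ordered (i ∷ v) ▸ f (suc i ∷ Vec.map suc v)))
      ≈⟨ ∑-tuples-suc (allFin n) r _ ⟨
    ∑ (tuples (allFin n) (suc r)) (λ v → ordered v ▸ f (Vec.map suc v))
      ≈⟨ ∑-filter (linked? Finₚ._<?_) (tuples (allFin n) (suc r)) _ ⟨
    ∑ (increasing n (suc r)) (λ v → f (Vec.map suc v)) ∎

  -- A second `zero` is excluded by strictness, and the test of `zero` against `suc i` computes to
  -- `true`, so only the order among the later entries remains to be tested.
  ∑-ordered-after-zero : ∀ n r (f : Vec (Fin (suc n)) r → Carrier) →
    ∑ (tuples (allFin (suc n)) r) (λ v → ordered (zero ∷ v) ▸ f v) ≈
    ∑ (increasing n r) (λ v → f (Vec.map suc v))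
  ∑-ordered-after-zero n zero    f = refl
  ∑-ordered-after-zero n (suc r) f = begin
    ∑ (tuples (allFin (suc n)) (suc r)) (λ v → ordered (zero ∷ v) ▸ f v)
      ≈⟨ ∑-tuples-suc (allFin (suc n)) r _ ⟩
    ∑ (allFin (suc n)) (λ i → ∑ (tuples (allFin (suc n)) r) (λ v → ordered (zero ∷ i ∷ v) ▸ f (i ∷ v)))
      ≈⟨ reflexive (∑-allFin-suc n _) ⟩
    ∑ (tuples (allFin (suc n)) r) (λ _ → 0#) +
    ∑ (allFin n) (λ i → ∑ (tuples (allFin (suc n)) r) (λ v → ordered (suc i ∷ v) ▸ f (suc i ∷ v)))
      ≈⟨ trans (+-congʳ (∑-zero (tuples (allFin (suc n)) r))) (+-identityˡ _) ⟩
    ∑ (allFin n) (λ i → ∑ (tuples (allFin (suc n)) r) (λ v → ordered (suc i ∷ v) ▸ f (suc i ∷ v)))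
      ≈⟨ ∑-ordered-suc n r f ⟩
    ∑ (increasing n (suc r)) (λ v → f (Vec.map suc v)) ∎

  -- The least index is either `zero` or a successor. This recursion on `n` is the one that is later
  -- matched with the recursion of `generating`.
  ∑-increasing-suc : ∀ n r (f : Vec (Fin (suc n)) (suc r) → Carrier) →
    ∑ (increasing (suc n) (suc r)) f ≈
    ∑ (increasing n r) (λ v → f (zero ∷ Vec.map suc v)) + ∑ (increasing n (suc r)) (λ v → f (Vec.map suc v))
  ∑-increasing-suc n r f = begin
    ∑ (increasing (suc n) (suc r)) f
      ≈⟨ ∑-filter (linked? Finₚ._<?_) (tuples (allFin (suc n)) (suc r)) f ⟩
    ∑ (tuples (allFin (suc n)) (suc r)) (λ v → ordered v ▸ f v)
      ≈⟨ ∑-tuples-suc (allFin (suc n)) r _ ⟩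
    ∑ (allFin (suc n)) (λ i → ∑ (tuples (allFin (suc n)) r) (λ v → ordered (i ∷ v) ▸ f (i ∷ v)))
      ≈⟨ reflexive (∑-allFin-suc n _) ⟩
    ∑ (tuples (allFin (suc n)) r) (λ v → ordered (zero ∷ v) ▸ f (zero ∷ v)) +
    ∑ (allFin n) (λ i → ∑ (tuples (allFin (suc n)) r) (λ v → ordered (suc i ∷ v) ▸ f (suc i ∷ v)))
      ≈⟨ +-cong (∑-ordered-after-zero n r (λ v → f (zero ∷ v))) (∑-ordered-suc n r f) ⟩
    ∑ (increasing n r) (λ v → f (zero ∷ Vec.map suc v)) + ∑ (increasing n (suc r)) (λ v → f (Vec.map suc v)) ∎

-- Membership in I₀(k, r, h) as a recursion on the entries

-- Whether the entries of a tuple contribute XᵖYᵠZˢ when an entry 1 counts as Y, an entry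
-- 2 + i as XⁱZ, and the last entry, which has to be of the form 2 + i, as Xⁱ only.
hasExponents : ∀ {r} → Vec ℕ (suc r) → (p q s : ℕ) → Bool
hasExponents {zero}  (k ∷ [])           p zero    zero    = k ≡ᵇ 2 ℕ.+ p
hasExponents {zero}  (k ∷ [])           p zero    (suc s) = false
hasExponents {zero}  (k ∷ [])           p (suc q) s       = false
hasExponents {suc r} (0 ∷ ks)           p q       s       = false
hasExponents {suc r} (1 ∷ ks)           p zero    s       = false
hasExponents {suc r} (1 ∷ ks)           p (suc q) s       = hasExponents ks p q s
hasExponents {suc r} (suc (suc i) ∷ ks) p q       zero    = false
hasExponents {suc r} (suc (suc i) ∷ ks) p q       (suc s) = (i ≤ᵇ p) ∧ hasExponents ks (p ∸ i) q s

-- A positive entry adds at least 1 to the sum, and at least 2 if it is counted.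
length+count≤sum : ∀ {r} (ks : Vec ℕ r) → Allᵥ (0 ℕ.<_) ks → r ℕ.+ count (1 ℕₚ.<?_) ks ℕ.≤ Vec.sum ks
length+count≤sum []                 []         = z≤n
length+count≤sum (1 ∷ ks)           (_ ∷ 0<ks) = s≤s (length+count≤sum ks 0<ks)
length+count≤sum {suc r} (suc (suc i) ∷ ks) (_ ∷ 0<ks) = begin
  suc (r ℕ.+ suc (count (1 ℕₚ.<?_) ks)) ≡⟨ ≡.cong suc (ℕₚ.+-suc r _) ⟩
  2 ℕ.+ (r ℕ.+ count (1 ℕₚ.<?_) ks)     ≤⟨ s≤s (s≤s (length+count≤sum ks 0<ks)) ⟩
  2 ℕ.+ Vec.sum ks                      ≤⟨ s≤s (s≤s (ℕₚ.m≤n+m (Vec.sum ks) i)) ⟩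
  2 ℕ.+ (i ℕ.+ Vec.sum ks)              ∎
  where open ℕₚ.≤-Reasoning

1<last⇒0<count : ∀ {r} (ks : Vec ℕ (suc r)) → 1 ℕ.< last ks → 0 ℕ.< count (1 ℕₚ.<?_) ks
1<last⇒0<count {zero}  (suc (suc k) ∷ []) 1<last = s≤s z≤n
1<last⇒0<count {zero}  (1 ∷ [])           (s≤s ())
1<last⇒0<count {suc r} (0 ∷ ks)           1<last = 1<last⇒0<count ks 1<last
1<last⇒0<count {suc r} (1 ∷ ks)           1<last = 1<last⇒0<count ks 1<last
1<last⇒0<count {suc r} (suc (suc k) ∷ ks) 1<last = s≤s z≤n

-- The global conditions become local ones: a leading 1 uses up one Y, a leading 2 + i uses up XⁱZ,
-- and in both cases the two sides of `r ≡ s + q` drop by one. The depth is `suc r` and the height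
-- `suc s` because the last entry is counted in both but uses up neither Y nor Z.
isI₀≡hasExponents : ∀ {r} p q s (ks : Vec ℕ (suc r)) → Allᵥ (0 ℕ.<_) ks → r ≡ s ℕ.+ q →
  does (isI₀? (suc s ℕ.+ q ℕ.+ suc s ℕ.+ p) r (suc s) ks) ≡ hasExponents ks p q s
isI₀≡hasExponents {zero} p zero zero (0 ∷ []) _ _ = ≡.refl
isI₀≡hasExponents {zero} p zero zero (1 ∷ []) _ _ = ≡.refl
isI₀≡hasExponents {zero} p zero zero (suc (suc k) ∷ []) _ _
  rewrite ℕₚ.+-identityʳ k = Boolₚ.∧-identityʳ (k ≡ᵇ p)
isI₀≡hasExponents {suc r} p q s (0 ∷ ks) (() ∷ _) _
-- For `q = 0` height and depth agree, so every entry has to exceed 1; after a leading 1 too few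
-- positions are left.
isI₀≡hasExponents {suc r} p zero s (1 ∷ ks) 0<ks r≡ =
  dec-false (isI₀? (suc s ℕ.+ 0 ℕ.+ suc s ℕ.+ p) (suc r) (suc s) (1 ∷ ks)) λ (_ , _ , count≡) →
    ℕₚ.<⇒≱ (ℕₚ.≤-reflexive (begin
      suc (suc r)             ≡⟨ ≡.cong suc r≡ ⟩
      suc (s ℕ.+ 0)           ≡⟨ ≡.cong suc (ℕₚ.+-identityʳ s) ⟩
      suc s                   ≡⟨ count≡ ⟨
      count (1 ℕₚ.<?_) ks     ∎)) (Vecₚ.count≤n (1 ℕₚ.<?_) ks)
  where open ≡.≡-Reasoning
isI₀≡hasExponents {suc r} p (suc q) s (1 ∷ ks) (_ ∷ 0<ks) r≡
  rewrite ℕₚ.+-suc s q = isI₀≡hasExponents p q s ks 0<ks (ℕₚ.suc-injective r≡)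
-- The height is 1 and the leading entry already accounts for it, but the last entry must exceed 1
-- as well.
isI₀≡hasExponents {suc r} p q zero (suc (suc i) ∷ ks) _ _ =
  dec-false (isI₀? (1 ℕ.+ q ℕ.+ 1 ℕ.+ p) (suc r) 1 (suc (suc i) ∷ ks)) λ (1<last , _ , count≡) →
    ℕₚ.<⇒≢ (1<last⇒0<count ks 1<last) (≡.sym (ℕₚ.suc-injective count≡))
isI₀≡hasExponents {suc r} p q (suc s) (suc (suc i) ∷ ks) (_ ∷ 0<ks) r≡ with i ℕₚ.≤? p
-- The summand 2 of the leading entry has cancelled against the prescribed sum by computation; `i`
-- is split off from `p` and cancelled too.
... | yes i≤p = begin
  does (1 ℕₚ.<? last ks) ∧ (i ℕ.+ Vec.sum ks ≡ᵇ s ℕ.+ q ℕ.+ suc (suc s) ℕ.+ p) ∧ (count (1 ℕₚ.<?_) ks ≡ᵇ suc s)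
    ≡⟨ ≡.cong (λ b → does (1 ℕₚ.<? last ks) ∧ b ∧ (count (1 ℕₚ.<?_) ks ≡ᵇ suc s)) sum-eq ⟩
  does (isI₀? (suc s ℕ.+ q ℕ.+ suc s ℕ.+ (p ∸ i)) r (suc s) ks)
    ≡⟨ isI₀≡hasExponents (p ∸ i) q s ks 0<ks (ℕₚ.suc-injective r≡) ⟩
  hasExponents ks (p ∸ i) q s
    ≡⟨ ≡.cong (_∧ hasExponents ks (p ∸ i) q s) (dec-true (i ℕₚ.≤? p) i≤p) ⟨
  (i ≤ᵇ p) ∧ hasExponents ks (p ∸ i) q s ∎
  where
  open ≡.≡-Reasoning
  ≡ᵇ-cancelˡ : ∀ i m n → (i ℕ.+ m ≡ᵇ i ℕ.+ n) ≡ (m ≡ᵇ n)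
  ≡ᵇ-cancelˡ zero    m n = ≡.refl
  ≡ᵇ-cancelˡ (suc i) m n = ≡ᵇ-cancelˡ i m n
  k : ℕ
  k = suc s ℕ.+ q ℕ.+ suc s
  k+p≡ : s ℕ.+ q ℕ.+ suc (suc s) ℕ.+ p ≡ i ℕ.+ (k ℕ.+ (p ∸ i))
  k+p≡ = begin
    s ℕ.+ q ℕ.+ suc (suc s) ℕ.+ p ≡⟨ ≡.cong (ℕ._+ p) (ℕₚ.+-suc (s ℕ.+ q) (suc s)) ⟩
    k ℕ.+ p                       ≡⟨ ≡.cong (k ℕ.+_) (ℕₚ.m+[n∸m]≡n i≤p) ⟨
    k ℕ.+ (i ℕ.+ (p ∸ i))         ≡⟨ ℕ+CS.x∙yz≈y∙xz k i (p ∸ i) ⟩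
    i ℕ.+ (k ℕ.+ (p ∸ i))         ∎
  sum-eq : (i ℕ.+ Vec.sum ks ≡ᵇ s ℕ.+ q ℕ.+ suc (suc s) ℕ.+ p) ≡ (Vec.sum ks ≡ᵇ k ℕ.+ (p ∸ i))
  sum-eq = ≡.trans (≡.cong (i ℕ.+ Vec.sum ks ≡ᵇ_) k+p≡) (≡ᵇ-cancelˡ i _ _)
-- The remaining entries sum to at least their length plus their number of entries above 1, which
-- leaves at most `p` for `i`.
... | no i≰p = ≡.trans
  (dec-false (isI₀? (suc (suc s) ℕ.+ q ℕ.+ suc (suc s) ℕ.+ p) (suc r) (suc (suc s)) (suc (suc i) ∷ ks)) λ (_ , sum≡ , count≡) →
    ℕₚ.<⇒≢ (begin-strict
      s ℕ.+ q ℕ.+ suc (suc s) ℕ.+ p           ≡⟨ ≡.cong (ℕ._+ p) (ℕₚ.+-suc (s ℕ.+ q) (suc s)) ⟩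
      suc s ℕ.+ q ℕ.+ suc s ℕ.+ p             ≡⟨ ≡.cong₂ (λ m n → m ℕ.+ n ℕ.+ p) r≡ (ℕₚ.suc-injective count≡) ⟨
      suc r ℕ.+ count (1 ℕₚ.<?_) ks ℕ.+ p     ≤⟨ ℕₚ.+-monoˡ-≤ p (length+count≤sum ks 0<ks) ⟩
      Vec.sum ks ℕ.+ p                        <⟨ ℕₚ.+-monoʳ-< (Vec.sum ks) (ℕₚ.≰⇒> i≰p) ⟩
      Vec.sum ks ℕ.+ i                        ≡⟨ ℕₚ.+-comm (Vec.sum ks) i ⟩
      i ℕ.+ Vec.sum ks                        ∎)
      (≡.sym (ℕₚ.suc-injective (ℕₚ.suc-injective sum≡))))
  (≡.sym (≡.cong (_∧ hasExponents ks (p ∸ i) q s) (dec-false (i ℕₚ.≤? p) i≰p)))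
  where open ℕₚ.≤-Reasoning

last-map : ∀ {r} (f : I → J) (v : Vec I (suc r)) → last (Vec.map f v) ≡ f (last v)
last-map {r = zero}  f (x ∷ []) = ≡.refl
last-map {r = suc r} f (x ∷ v)  = last-map f v

-- Coefficients of products in one variable

module SeriesCoefficients (A : CommutativeRing a ℓ) where
  open CommutativeRing A hiding (zero)
  open PowerSeries A
  private
    module A⟦t⟧ = CommutativeRing seriesRing

  const-⊛ : ∀ x g n → (const x ⊛ g) n ≈ x * g n
  const-⊛ x g zero    = refl
  const-⊛ x g (suc n) = trans (+-congˡ (A⟦t⟧.zeroˡ g n)) (+-identityʳ _)

  t-⊛-zero : ∀ g → (t ⊛ g) 0 ≈ 0#
  t-⊛-zero g = zeroˡ (g 0)

  t-⊛-suc : ∀ g n → (t ⊛ g) (suc n) ≈ g n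
  t-⊛-suc g n = trans (+-cong (zeroˡ _) (trans (A⟦t⟧.*-congʳ {g} tail-t n) (A⟦t⟧.*-identityˡ g n))) (+-identityˡ _)
    where
    tail-t : tail t ≋ const 1#
    tail-t zero    = refl
    tail-t (suc n) = refl

-- Coefficient sums over indices and exponents

module TripleSeries (A : CommutativeRing a ℓ) where
  open CommutativeRing A hiding (zero)
  open RingNotions A
  open FiniteSums A
  open SetoidReasoning setoid
  private
    module R where
      open CommutativeRing (K⟦X,Y,Z⟧ A) public
      open RingNotions (K⟦X,Y,Z⟧ A) public

  -- Multiplication by Y and by Z, read off on coefficients.
  shiftʸ shiftᶻ : (ℕ → ℕ → ℕ → Carrier) → ℕ → ℕ → ℕ → Carrier
  shiftʸ f p zero    s = 0#
  shiftʸ f p (suc q) s = f p q s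
  shiftᶻ f p q zero    = 0#
  shiftᶻ f p q (suc s) = f p q s

  -- Written with the same fold and zip as `Li`, so that for `u j` equal to 1/(j + 1) the summands
  -- agree by computation.
  monomial : ∀ {n r} → (ℕ → Carrier) → Vec (Fin n) r → Vec ℕ r → Carrier
  monomial u js ks = Vec.foldr′ _*_ 1# (Vec.zipWith (λ j k → u (toℕ j) ^ k) js ks)

  monomial-map-suc : ∀ {n r} u (js : Vec (Fin n) r) ks →
                     monomial u (Vec.map suc js) ks ≡ monomial (u ∘ suc) js ks
  monomial-map-suc u []       []       = ≡.refl
  monomial-map-suc u (j ∷ js) (k ∷ ks) = ≡.cong (u (suc (toℕ j)) ^ k *_) (monomial-map-suc u js ks)

  module _ {n} (u : ℕ → Carrier) (w : Fin n → Carrier) (b : ℕ) where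
    -- `u` and `w` are arbitrary so that an induction on `n` can pass to `u ∘ suc` and `w ∘ suc`.
    -- The bound `b` on the exponents keeps the sum over exponent tuples finite.
    coefficientAt : ∀ {r} → Vec (Fin n) (suc r) → (p q s : ℕ) → Carrier
    coefficientAt {r} js p q s = ∑ (tuples (applyUpTo suc b) (suc r)) λ ks →
      hasExponents ks p q s ▸ monomial u js ks * w (last js)

    coefficient : ∀ r p q s → Carrier
    coefficient r p q s = ∑ (increasing n (suc r)) λ js → coefficientAt js p q s

  module _ {n} (u : ℕ → Carrier) (w : Fin (suc n) → Carrier) (b : ℕ) where
    private
      at : ∀ {r} → Vec (Fin n) (suc r) → (p q s : ℕ) → Carrier
      at = coefficientAt (u ∘ suc) (w ∘ suc) (suc b)

    term-map-suc : ∀ {r} x (js : Vec (Fin n) (suc r)) ks →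
      x * monomial u (Vec.map suc js) ks * w (last (Vec.map suc js)) ≈
      x * (monomial (u ∘ suc) js ks * w (suc (last js)))
    term-map-suc x js ks = trans
      (*-cong (*-congˡ (reflexive (monomial-map-suc u js ks))) (reflexive (≡.cong w (last-map suc js))))
      (*-assoc _ _ _)

    coefficientAt-map-suc : ∀ {r} (js : Vec (Fin n) (suc r)) p q s →
      coefficientAt u w (suc b) (Vec.map suc js) p q s ≈ at js p q s
    coefficientAt-map-suc {r} js p q s = ∑-cong (tuples (applyUpTo suc (suc b)) (suc r)) λ ks →
      ▸-cong (hasExponents ks p q s) (*-cong (reflexive (monomial-map-suc u js ks)) (reflexive (≡.cong w (last-map suc js))))

    ∑-tuples-factor : ∀ {r} x (js : Vec (Fin n) (suc r)) p q s →
      ∑ (tuples (applyUpTo suc (suc b)) (suc r))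
        (λ ks → hasExponents ks p q s ▸ x * monomial u (Vec.map suc js) ks * w (last (Vec.map suc js))) ≈
      x * at js p q s
    ∑-tuples-factor {r} x js p q s = trans
      (∑-cong (tuples (applyUpTo suc (suc b)) (suc r)) λ ks → trans
        (▸-cong (hasExponents ks p q s) (term-map-suc x js ks))
        (▸-* (hasExponents ks p q s) x _))
      (∑-* (tuples (applyUpTo suc (suc b)) (suc r)) x _)

    -- The first exponent decides: 1 contributes `u 0` and one Y, while 2 + i contributes
    -- `u 0 ^ (2 + i)` and XⁱZ. Exponents run up to `suc b`, hence i runs from 0 to b - 1.
    coefficientAt-zero∷ : ∀ {r} (js : Vec (Fin n) (suc r)) p q s →
      coefficientAt u w (suc b) (zero ∷ Vec.map suc js) p q s ≈
      u 0 * shiftʸ (at js) p q s +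
      ∑ (upTo b) (λ i → (i ≤ᵇ p) ▸ u 0 ^ (2 ℕ.+ i) * shiftᶻ (at js) (p ∸ i) q s)
    coefficientAt-zero∷ {r} js p q s = begin
      coefficientAt u w (suc b) (zero ∷ Vec.map suc js) p q s
        ≈⟨ ∑-tuples-suc (applyUpTo suc (suc b)) (suc r) _ ⟩
      inner 1 + ∑ (applyUpTo (2 ℕ.+_) b) inner
        ≈⟨ +-cong (one q) (trans (reflexive (∑-applyUpTo (2 ℕ.+_) id b inner)) (∑-cong (upTo b) (λ i → big i s))) ⟩
      u 0 * shiftʸ (at js) p q s +
      ∑ (upTo b) (λ i → (i ≤ᵇ p) ▸ u 0 ^ (2 ℕ.+ i) * shiftᶻ (at js) (p ∸ i) q s) ∎
      where
      kss : List (Vec ℕ (suc r))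
      kss = tuples (applyUpTo suc (suc b)) (suc r)
      term : ℕ → Vec ℕ (suc r) → Carrier
      term k ks = u 0 ^ k * monomial u (Vec.map suc js) ks * w (last (Vec.map suc js))
      inner : ℕ → Carrier
      inner k = ∑ kss λ ks → hasExponents (k ∷ ks) p q s ▸ term k ks
      one : ∀ q → ∑ kss (λ ks → hasExponents (1 ∷ ks) p q s ▸ term 1 ks) ≈ u 0 * shiftʸ (at js) p q s
      one zero    = trans (∑-zero kss) (sym (zeroʳ (u 0)))
      one (suc q) = trans (∑-tuples-factor (u 0 ^ 1) js p q s) (*-congʳ (*-identityʳ (u 0)))
      big : ∀ i s → ∑ kss (λ ks → hasExponents (2 ℕ.+ i ∷ ks) p q s ▸ term (2 ℕ.+ i) ks) ≈
                    ((i ≤ᵇ p) ▸ u 0 ^ (2 ℕ.+ i) * shiftᶻ (at js) (p ∸ i) q s)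
      big i zero    = trans (∑-zero kss) (sym (trans (▸-cong (i ≤ᵇ p) (zeroʳ _)) (▸-0 (i ≤ᵇ p))))
      big i (suc s) = begin
        ∑ kss (λ ks → ((i ≤ᵇ p) ∧ hasExponents ks (p ∸ i) q s) ▸ term (2 ℕ.+ i) ks)
          ≈⟨ ∑-cong kss (λ ks → reflexive (▸-∧ (i ≤ᵇ p) _ _)) ⟩
        ∑ kss (λ ks → (i ≤ᵇ p) ▸ hasExponents ks (p ∸ i) q s ▸ term (2 ℕ.+ i) ks)
          ≈⟨ ∑-▸ kss (i ≤ᵇ p) _ ⟩
        ((i ≤ᵇ p) ▸ ∑ kss (λ ks → hasExponents ks (p ∸ i) q s ▸ term (2 ℕ.+ i) ks))
          ≈⟨ ▸-cong (i ≤ᵇ p) (∑-tuples-factor (u 0 ^ (2 ℕ.+ i)) js (p ∸ i) q s) ⟩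
        ((i ≤ᵇ p) ▸ u 0 ^ (2 ℕ.+ i) * at js (p ∸ i) q s) ∎

    private
      coeff : ∀ r p q s → Carrier
      coeff = coefficient (u ∘ suc) (w ∘ suc) (suc b)

    ∑-shiftʸ : ∀ {r} p q s → ∑ (increasing n (suc r)) (λ js → shiftʸ (at js) p q s) ≈ shiftʸ (coeff r) p q s
    ∑-shiftʸ {r} p zero    s = ∑-zero (increasing n (suc r))
    ∑-shiftʸ {r} p (suc q) s = refl

    ∑-shiftᶻ : ∀ {r} p q s → ∑ (increasing n (suc r)) (λ js → shiftᶻ (at js) p q s) ≈ shiftᶻ (coeff r) p q s
    ∑-shiftᶻ {r} p q zero    = ∑-zero (increasing n (suc r))
    ∑-shiftᶻ {r} p q (suc s) = refl

    -- The depth is at least two, so a least index `zero` is not the last one: it contributes a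
    -- factor Y or XⁱZ and leaves a tuple of depth one less. Otherwise all indices are successors
    -- and the depth stays.
    coefficient-suc-suc : ∀ r p q s →
      coefficient u w (suc b) (suc r) p q s ≈
      (u 0 * shiftʸ (coeff r) p q s +
       ∑ (upTo b) (λ i → (i ≤ᵇ p) ▸ u 0 ^ (2 ℕ.+ i) * shiftᶻ (coeff r) (p ∸ i) q s)) +
      coeff (suc r) p q s
    coefficient-suc-suc r p q s = begin
      coefficient u w (suc b) (suc r) p q s
        ≈⟨ ∑-increasing-suc n (suc r) _ ⟩
      ∑ jss (λ js → coefficientAt u w (suc b) (zero ∷ Vec.map suc js) p q s) +
      ∑ (increasing n (suc (suc r))) (λ js → coefficientAt u w (suc b) (Vec.map suc js) p q s)
        ≈⟨ +-cong (∑-cong jss (λ js → coefficientAt-zero∷ js p q s))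
                  (∑-cong (increasing n (suc (suc r))) (λ js → coefficientAt-map-suc js p q s)) ⟩
      ∑ jss (λ js → u 0 * shiftʸ (at js) p q s + ∑ (upTo b) (λ i → bigs i js)) + coeff (suc r) p q s
        ≈⟨ +-congʳ (∑-+ jss _ _) ⟩
      (∑ jss (λ js → u 0 * shiftʸ (at js) p q s) + ∑ jss (λ js → ∑ (upTo b) (λ i → bigs i js))) + coeff (suc r) p q s
        ≈⟨ +-congʳ (+-cong (trans (∑-* jss (u 0) _) (*-congˡ (∑-shiftʸ p q s)))
                           (trans (∑-swap jss (upTo b) _) (∑-cong (upTo b) ∑-bigs))) ⟩
      (u 0 * shiftʸ (coeff r) p q s +
       ∑ (upTo b) (λ i → (i ≤ᵇ p) ▸ u 0 ^ (2 ℕ.+ i) * shiftᶻ (coeff r) (p ∸ i) q s)) +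
      coeff (suc r) p q s ∎
      where
      jss : List (Vec (Fin n) (suc r))
      jss = increasing n (suc r)
      bigs : ℕ → Vec (Fin n) (suc r) → Carrier
      bigs i js = (i ≤ᵇ p) ▸ u 0 ^ (2 ℕ.+ i) * shiftᶻ (at js) (p ∸ i) q s
      ∑-bigs : ∀ i → ∑ jss (bigs i) ≈ ((i ≤ᵇ p) ▸ u 0 ^ (2 ℕ.+ i) * shiftᶻ (coeff r) (p ∸ i) q s)
      ∑-bigs i = trans (∑-▸ jss (i ≤ᵇ p) _)
        (▸-cong (i ≤ᵇ p) (trans (∑-* jss _ _) (*-congˡ (∑-shiftᶻ (p ∸ i) q s))))

    coefficient-suc-zero : ∀ p → p ℕ.< b →
      coefficient u w (suc b) 0 p 0 0 ≈ u 0 ^ (2 ℕ.+ p) * w zero + coeff 0 p 0 0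
    coefficient-suc-zero p p<b = begin
      coefficient u w (suc b) 0 p 0 0
        ≈⟨ ∑-increasing-suc n 0 _ ⟩
      (coefficientAt u w (suc b) (zero ∷ []) p 0 0 + 0#) +
      ∑ (increasing n 1) (λ js → coefficientAt u w (suc b) (Vec.map suc js) p 0 0)
        ≈⟨ +-cong (trans (+-identityʳ _) first) (∑-cong (increasing n 1) (λ js → coefficientAt-map-suc js p 0 0)) ⟩
      u 0 ^ (2 ℕ.+ p) * w zero + coeff 0 p 0 0 ∎
      where
      ∑-≡ᵇ : ∀ b p (f : ℕ → Carrier) → p ℕ.< b → ∑ (upTo b) (λ i → (i ≡ᵇ p) ▸ f i) ≈ f p
      ∑-≡ᵇ (suc b) zero f _ = trans
        (+-congˡ (trans (reflexive (∑-applyUpTo suc id b _)) (∑-zero (upTo b)))) (+-identityʳ _)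
      ∑-≡ᵇ (suc b) (suc p) f (s≤s p<b) = trans (+-identityˡ _)
        (trans (reflexive (∑-applyUpTo suc id b _)) (∑-≡ᵇ b p (f ∘ suc) p<b))
      term : ℕ → Carrier
      term k = u 0 ^ k * 1# * w zero
      first : coefficientAt u w (suc b) (zero ∷ []) p 0 0 ≈ u 0 ^ (2 ℕ.+ p) * w zero
      first = begin
        coefficientAt u w (suc b) (zero ∷ []) p 0 0
          ≈⟨ ∑-tuples-suc (applyUpTo suc (suc b)) 0 _ ⟩
        ∑ (applyUpTo suc (suc b)) (λ k → ((k ≡ᵇ 2 ℕ.+ p) ▸ term k) + 0#)
          ≈⟨ ∑-cong (applyUpTo suc (suc b)) (λ _ → +-identityʳ _) ⟩
        -- The leading `0#` is the exponent 1, which differs from 2 + p.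
        0# + ∑ (applyUpTo (2 ℕ.+_) b) (λ k → (k ≡ᵇ 2 ℕ.+ p) ▸ term k)
          ≈⟨ +-identityˡ _ ⟩
        ∑ (applyUpTo (2 ℕ.+_) b) (λ k → (k ≡ᵇ 2 ℕ.+ p) ▸ term k)
          ≈⟨ reflexive (∑-applyUpTo (2 ℕ.+_) id b _) ⟩
        ∑ (upTo b) (λ i → (i ≡ᵇ p) ▸ term (2 ℕ.+ i))
          ≈⟨ ∑-≡ᵇ b p (λ i → term (2 ℕ.+ i)) p<b ⟩
        term (2 ℕ.+ p)
          ≈⟨ *-congʳ (*-identityʳ _) ⟩
        u 0 ^ (2 ℕ.+ p) * w zero ∎

  -- Coefficients of products in three variables

  private
    module A⟦Z⟧   = CommutativeRing (PowerSeries.seriesRing A)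
    module A⟦Y,Z⟧ = CommutativeRing (PowerSeries.seriesRing (PowerSeries.seriesRing A))
    module C₁ = SeriesCoefficients A
    module C₂ = SeriesCoefficients (PowerSeries.seriesRing A)
    module C₃ = SeriesCoefficients (PowerSeries.seriesRing (PowerSeries.seriesRing A))

    constʸᶻ : Carrier → A⟦Y,Z⟧.Carrier
    constʸᶻ x = PowerSeries.const (PowerSeries.seriesRing A) (PowerSeries.const A x)

    constʸᶻ-* : ∀ x f q s → (constʸᶻ x A⟦Y,Z⟧.* f) q s ≈ x * f q s
    constʸᶻ-* x f q s = trans (C₂.const-⊛ _ f q s) (C₁.const-⊛ x (f q) s)

    constʸᶻ-cong : ∀ {x y} → x ≈ y → constʸᶻ x A⟦Y,Z⟧.≈ constʸᶻ y
    constʸᶻ-cong x≈y zero    zero    = x≈y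
    constʸᶻ-cong x≈y zero    (suc s) = refl
    constʸᶻ-cong x≈y (suc q) s       = refl

  shiftˣ : (ℕ → ℕ → ℕ → Carrier) → ℕ → ℕ → ℕ → Carrier
  shiftˣ f zero    q s = 0#
  shiftˣ f (suc p) q s = f p q s

  scalar-* : ∀ x f p q s → (scalar A x R.* f) p q s ≈ x * f p q s
  scalar-* x f p q s = trans (C₃.const-⊛ _ f p q s) (constʸᶻ-* x (f p) q s)

  X-* : ∀ f p q s → (𝐗 A R.* f) p q s ≈ shiftˣ f p q s
  X-* f zero    q s = C₃.t-⊛-zero f q s
  X-* f (suc p) q s = C₃.t-⊛-suc f p q s

  Y-* : ∀ f p q s → (𝐘 A R.* f) p q s ≈ shiftʸ f p q s
  Y-* f p zero    s = trans (C₃.const-⊛ _ f p 0 s) (C₂.t-⊛-zero (f p) s)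
  Y-* f p (suc q) s = trans (C₃.const-⊛ _ f p (suc q) s) (C₂.t-⊛-suc (f p) q s)

  Z-* : ∀ f p q s → (𝐙 A R.* f) p q s ≈ shiftᶻ f p q s
  Z-* f p q zero    = trans (C₃.const-⊛ _ f p q 0) (trans (C₂.const-⊛ _ (f p) q 0) (C₁.t-⊛-zero (f p q)))
  Z-* f p q (suc s) = trans (C₃.const-⊛ _ f p q (suc s)) (trans (C₂.const-⊛ _ (f p) q (suc s)) (C₁.t-⊛-suc (f p q) s))

  seriesInX : (ℕ → Carrier) → R.Carrier
  seriesInX g p = constʸᶻ (g p)

  ∑-upTo-suc : ∀ b (f : ℕ → Carrier) →
          f 0 + ∑ (upTo b) (f ∘ suc) ≡ ∑ (upTo (suc b)) f
  ∑-upTo-suc b f = ≡.cong (f 0 +_) (≡.sym (∑-applyUpTo suc id b f))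

  -- Any bound beyond `p` gives the Cauchy product in X: the guard discards the indices `i > p`, for
  -- which `p ∸ i` would wrongly read off the coefficient of X⁰.
  seriesInX-* : ∀ g f b p q s → p ℕ.< b →
    (seriesInX g R.* f) p q s ≈ ∑ (upTo b) (λ i → (i ≤ᵇ p) ▸ g i * f (p ∸ i) q s)
  seriesInX-* g f (suc b) zero q s p<b = begin
    (constʸᶻ (g 0) A⟦Y,Z⟧.* f 0) q s          ≈⟨ constʸᶻ-* (g 0) (f 0) q s ⟩
    g 0 * f 0 q s                             ≈⟨ +-identityʳ _ ⟨
    g 0 * f 0 q s + 0#                        ≈⟨ +-congˡ (∑-zero (upTo b)) ⟨
    g 0 * f 0 q s + ∑ (upTo b) (λ _ → 0#)     ≈⟨ reflexive (∑-upTo-suc b _) ⟩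
    ∑ (upTo (suc b)) (λ i → (i ≤ᵇ 0) ▸ g i * f (0 ∸ i) q s) ∎
  seriesInX-* g f (suc b) (suc p) q s (s≤s p<b) = begin
    (constʸᶻ (g 0) A⟦Y,Z⟧.* f (suc p)) q s + (seriesInX (g ∘ suc) R.* f) p q s
      ≈⟨ +-cong (constʸᶻ-* (g 0) (f (suc p)) q s) (seriesInX-* (g ∘ suc) f b p q s p<b) ⟩
    g 0 * f (suc p) q s + ∑ (upTo b) (λ i → (i ≤ᵇ p) ▸ g (suc i) * f (p ∸ i) q s)
      ≈⟨ +-congˡ (∑-cong (upTo b) (λ i → reflexive (≡.cong (_▸ g (suc i) * f (p ∸ i) q s) (≤ᵇ-suc i)))) ⟩
    g 0 * f (suc p) q s + ∑ (upTo b) (λ i → (suc i ≤ᵇ suc p) ▸ g (suc i) * f (p ∸ i) q s)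
      ≈⟨ reflexive (∑-upTo-suc b _) ⟩
    ∑ (upTo (suc b)) (λ i → (i ≤ᵇ suc p) ▸ g i * f (suc p ∸ i) q s) ∎
    where
    ≤ᵇ-suc : ∀ i → (i ≤ᵇ p) ≡ (suc i ≤ᵇ suc p)
    ≤ᵇ-suc zero    = ≡.refl
    ≤ᵇ-suc (suc i) = ≡.refl

  -- The factors of the generating function and its coefficients

  -- x² / (1 - x X)
  big : Carrier → R.Carrier
  big x = seriesInX (λ i → x ^ (2 ℕ.+ i))

  -- Functional equation of the geometric series. For x = 1/m it is what identifies `big x` as the
  -- inverse of m(m - X).
  big-recursive : ∀ x → big x R.≈ scalar A x R.* scalar A x R.+ scalar A x R.* (𝐗 A R.* big x)
  big-recursive x p q s = sym (begin
    (scalar A x R.* scalar A x) p q s + (scalar A x R.* (𝐗 A R.* big x)) p q s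
      ≈⟨ +-cong (scalar-* x (scalar A x) p q s) (trans (scalar-* x (𝐗 A R.* big x) p q s) (*-congˡ (X-* (big x) p q s))) ⟩
    x * scalar A x p q s + x * shiftˣ (big x) p q s
      ≈⟨ coefficients p q s ⟩
    big x p q s ∎)
    where
    coefficients : ∀ p q s → x * scalar A x p q s + x * shiftˣ (big x) p q s ≈ big x p q s
    coefficients zero    zero    zero    = trans (+-cong (*-congˡ (sym (*-identityʳ x))) (zeroʳ x)) (+-identityʳ _)
    coefficients zero    zero    (suc s) = trans (+-cong (zeroʳ x) (zeroʳ x)) (+-identityʳ _)
    coefficients zero    (suc q) s       = trans (+-cong (zeroʳ x) (zeroʳ x)) (+-identityʳ _)
    coefficients (suc p) zero    zero    = trans (+-congʳ (zeroʳ x)) (+-identityˡ _)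
    coefficients (suc p) zero    (suc s) = trans (+-cong (zeroʳ x) (zeroʳ x)) (+-identityʳ _)
    coefficients (suc p) (suc q) s       = trans (+-cong (zeroʳ x) (zeroʳ x)) (+-identityʳ _)

  -- At x = 1/j the three summands 1, Y/j and Z/(j(j - X)) stand for the index j being skipped,
  -- taken with exponent 1, or taken with a larger exponent.
  factor : Carrier → R.Carrier
  factor x = R.1# R.+ (𝐘 A R.* scalar A x R.+ 𝐙 A R.* big x)

  factor-* : ∀ x f p q s →
    (factor x R.* f) p q s ≈ f p q s + (x * shiftʸ f p q s + shiftᶻ (big x R.* f) p q s)
  factor-* x f p q s = begin
    (factor x R.* f) p q s
      ≈⟨ expand p q s ⟩
    f p q s + ((scalar A x R.* (𝐘 A R.* f)) p q s + (𝐙 A R.* (big x R.* f)) p q s)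
      ≈⟨ +-congˡ (+-cong (trans (scalar-* x (𝐘 A R.* f) p q s) (*-congˡ (Y-* f p q s))) (Z-* (big x R.* f) p q s)) ⟩
    f p q s + (x * shiftʸ f p q s + shiftᶻ (big x R.* f) p q s) ∎
    where
    expand : factor x R.* f R.≈ f R.+ (scalar A x R.* (𝐘 A R.* f) R.+ 𝐙 A R.* (big x R.* f))
    expand = R.trans (R.distribʳ f R.1# (𝐘 A R.* scalar A x R.+ 𝐙 A R.* big x))
      (R.+-cong (R.*-identityˡ f)
        (R.trans (R.distribʳ f (𝐘 A R.* scalar A x) (𝐙 A R.* big x))
          (R.+-cong (R.trans (R.*-congʳ {f} (R.*-comm (𝐘 A) (scalar A x))) (R.*-assoc (scalar A x) (𝐘 A) f))
                    (R.*-assoc (𝐙 A) (big x) f))))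

  -- Σ_m w_m V(u_m) ∏_{i<m} F(u_i), with V = big and F = factor
  generating : ∀ n → (ℕ → Carrier) → (Fin n → Carrier) → R.Carrier
  generating zero    u w = R.0#
  generating (suc n) u w =
    scalar A (w zero) R.* big (u 0) R.+ factor (u 0) R.* generating n (u ∘ suc) (w ∘ suc)

  -- Both sides obey the same recursion on `n`: index 0 is the only one chosen, or it is skipped or
  -- chosen in front of a tuple of later indices. The equation `r ≡ s + q` expresses that each index
  -- before the last leaves exactly one Y or one Z.
  coefficient≈generating : ∀ n u (w : Fin n → Carrier) b r p q s → p ℕ.< b → r ≡ s ℕ.+ q →
    coefficient u w (suc b) r p q s ≈ generating n u w p q s
  coefficient≈generating zero    u w b r p q s p<b r≡ = refl
  coefficient≈generating (suc n) u w b r p q s p<b r≡ = begin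
    coefficient u w (suc b) r p q s
      ≈⟨ split r q s r≡ ⟩
    w zero * big (u 0) p q s + (g p q s + (u 0 * shiftʸ g p q s + shiftᶻ (big (u 0) R.* g) p q s))
      ≈⟨ +-cong (scalar-* (w zero) (big (u 0)) p q s) (factor-* (u 0) g p q s) ⟨
    generating (suc n) u w p q s ∎
    where
    g : R.Carrier
    g = generating n (u ∘ suc) (w ∘ suc)
    c : ∀ r p q s → Carrier
    c = coefficient (u ∘ suc) (w ∘ suc) (suc b)
    ih : ∀ r p q s → p ℕ.< b → r ≡ s ℕ.+ q → c r p q s ≈ g p q s
    ih = coefficient≈generating n (u ∘ suc) (w ∘ suc) b
    ihʸ : ∀ r q s → suc r ≡ s ℕ.+ q → shiftʸ (c r) p q s ≈ shiftʸ g p q s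
    ihʸ r zero    s r≡ = refl
    ihʸ r (suc q) s r≡ = ih r p q s p<b (ℕₚ.suc-injective (≡.trans r≡ (ℕₚ.+-suc s q)))
    ihᶻ : ∀ r q s → suc r ≡ s ℕ.+ q →
          ∑ (upTo b) (λ i → (i ≤ᵇ p) ▸ u 0 ^ (2 ℕ.+ i) * shiftᶻ (c r) (p ∸ i) q s) ≈
          shiftᶻ (big (u 0) R.* g) p q s
    ihᶻ r q zero    r≡ = trans
      (∑-cong (upTo b) (λ i → trans (▸-cong (i ≤ᵇ p) (zeroʳ _)) (▸-0 (i ≤ᵇ p)))) (∑-zero (upTo b))
    ihᶻ r q (suc s) r≡ = trans
      (∑-cong (upTo b) (λ i → ▸-cong (i ≤ᵇ p) (*-congˡ
        (ih r (p ∸ i) q s (ℕₚ.≤-<-trans (ℕₚ.m∸n≤m p i) p<b) (ℕₚ.suc-injective r≡)))))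
      (sym (seriesInX-* (λ i → u 0 ^ (2 ℕ.+ i)) g b p q s p<b))
    -- `big` involves X alone, so the one-index term contributes nothing in depth two or more.
    big-vanishes : ∀ r q s → suc r ≡ s ℕ.+ q → big (u 0) p q s ≈ 0#
    big-vanishes r zero    (suc s) _ = refl
    big-vanishes r (suc q) s       _ = refl
    split : ∀ r q s → r ≡ s ℕ.+ q → coefficient u w (suc b) r p q s ≈
      w zero * big (u 0) p q s + (g p q s + (u 0 * shiftʸ g p q s + shiftᶻ (big (u 0) R.* g) p q s))
    split zero zero zero r≡ = begin
      coefficient u w (suc b) 0 p 0 0          ≈⟨ coefficient-suc-zero u w b p p<b ⟩
      u 0 ^ (2 ℕ.+ p) * w zero + c 0 p 0 0     ≈⟨ +-cong (*-comm _ _) (ih 0 p 0 0 p<b ≡.refl) ⟩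
      w zero * u 0 ^ (2 ℕ.+ p) + g p 0 0
        ≈⟨ +-congˡ (trans (+-congˡ (trans (+-identityʳ _) (zeroʳ (u 0)))) (+-identityʳ _)) ⟨
      w zero * u 0 ^ (2 ℕ.+ p) + (g p 0 0 + (u 0 * 0# + 0#)) ∎
    split (suc r) q s r≡ = begin
      coefficient u w (suc b) (suc r) p q s
        ≈⟨ coefficient-suc-suc u w b r p q s ⟩
      (u 0 * shiftʸ (c r) p q s + ∑ (upTo b) (λ i → (i ≤ᵇ p) ▸ u 0 ^ (2 ℕ.+ i) * shiftᶻ (c r) (p ∸ i) q s)) + c (suc r) p q s
        ≈⟨ +-cong (+-cong (*-congˡ (ihʸ r q s r≡)) (ihᶻ r q s r≡)) (ih (suc r) p q s p<b r≡) ⟩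
      (u 0 * shiftʸ g p q s + shiftᶻ (big (u 0) R.* g) p q s) + g p q s
        ≈⟨ +-comm _ _ ⟩
      g p q s + (u 0 * shiftʸ g p q s + shiftᶻ (big (u 0) R.* g) p q s)
        ≈⟨ trans (+-congʳ (trans (*-congˡ (big-vanishes r q s r≡)) (zeroʳ (w zero)))) (+-identityˡ _) ⟨
      w zero * big (u 0) p q s + (g p q s + (u 0 * shiftʸ g p q s + shiftᶻ (big (u 0) R.* g) p q s)) ∎

  -- Cancellation of Z - XY, and inverses of scalars

  Z-XY-cancel : ∀ f g → (𝐙 A R.- 𝐗 A R.* 𝐘 A) R.* f R.≈ (𝐙 A R.- 𝐗 A R.* 𝐘 A) R.* g → f R.≈ g
  Z-XY-cancel f g Df≈Dg = cancel
    where
    open RingProperties ring using (+-cancelʳ)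
    XY-* : ∀ f p q s → ((𝐗 A R.* 𝐘 A) R.* f) p q s ≈ shiftˣ (shiftʸ f) p q s
    XY-* f p q s = trans (R.*-assoc (𝐗 A) (𝐘 A) f p q s) (trans (X-* (𝐘 A R.* f) p q s) (shift p))
      where
      shift : ∀ p → shiftˣ (𝐘 A R.* f) p q s ≈ shiftˣ (shiftʸ f) p q s
      shift zero    = refl
      shift (suc p) = Y-* f p q s
    D-* : ∀ f p q s → ((𝐙 A R.- 𝐗 A R.* 𝐘 A) R.* f) p q (suc s) ≈ f p q s + - shiftˣ (shiftʸ f) p q (suc s)
    D-* f p q s = begin
      ((𝐙 A R.- 𝐗 A R.* 𝐘 A) R.* f) p q (suc s)
        ≈⟨ R.distribʳ f (𝐙 A) (R.- (𝐗 A R.* 𝐘 A)) p q (suc s) ⟩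
      (𝐙 A R.* f) p q (suc s) + (R.- (𝐗 A R.* 𝐘 A) R.* f) p q (suc s)
        ≈⟨ +-cong (Z-* f p q (suc s)) (sym (RingProperties.-‿distribˡ-* R.ring (𝐗 A R.* 𝐘 A) f p q (suc s))) ⟩
      f p q s + - ((𝐗 A R.* 𝐘 A) R.* f) p q (suc s)
        ≈⟨ +-congˡ (-‿cong (XY-* f p q (suc s))) ⟩
      f p q s + - shiftˣ (shiftʸ f) p q (suc s) ∎
    -- Mutual recursion with `shifted`. It terminates because `p` drops at each round, although the
    -- Z-exponent grows.
    cancel : ∀ p q s → f p q s ≈ g p q s
    shifted : ∀ p q s → shiftˣ (shiftʸ f) p q s ≈ shiftˣ (shiftʸ g) p q s
    shifted zero    q       s = refl
    shifted (suc p) zero    s = refl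
    shifted (suc p) (suc q) s = cancel p q s
    cancel p q s = +-cancelʳ _ _ _ (begin
      f p q s + - shiftˣ (shiftʸ f) p q (suc s) ≈⟨ D-* f p q s ⟨
      ((𝐙 A R.- 𝐗 A R.* 𝐘 A) R.* f) p q (suc s) ≈⟨ Df≈Dg p q (suc s) ⟩
      ((𝐙 A R.- 𝐗 A R.* 𝐘 A) R.* g) p q (suc s) ≈⟨ D-* g p q s ⟩
      g p q s + - shiftˣ (shiftʸ g) p q (suc s) ≈⟨ +-congˡ (-‿cong (shifted p q (suc s))) ⟨
      g p q s + - shiftˣ (shiftʸ f) p q (suc s) ∎)

  scalar-isHom : IsHom A (K⟦X,Y,Z⟧ A) (scalar A)
  scalar-isHom = Composition.isRingHomomorphism R.trans
    (Composition.isRingHomomorphism A⟦Y,Z⟧.trans (PowerSeries.const-isHom A) (PowerSeries.const-isHom (PowerSeries.seriesRing A)))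
    (PowerSeries.const-isHom (PowerSeries.seriesRing (PowerSeries.seriesRing A)))

  scalar-inverse : ∀ m x → x * fromℕ m ≈ 1# → scalar A x R.* R.fromℕ m R.≈ R.1#
  scalar-inverse m x xm≈1 = R.trans
    (R.*-congˡ {scalar A x} (R.sym (HomProperties.fromℕ-homo {A = A} {B = K⟦X,Y,Z⟧ A} scalar-isHom m)))
    (R.trans (R.sym (*-homo x (fromℕ m))) (⟦⟧-cong xm≈1))
    where open IsRingHomomorphism scalar-isHom

-- Rational identities without division

module RationalIdentities (C : CommutativeRing a ℓ) where
  open CommutativeRing C hiding (zero)
  open RingNotions C
  open FiniteSums C
  open SetoidReasoning setoid
  private
    module Solver = Algebra.Solver.Ring.NaturalCoefficients.Default commutativeSemiring
    open Solver using (_:+_; _:*_; _:=_)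
    module *CS = CommutativeSemigroupProperties *-commutativeSemigroup

  recip-unique : ∀ {x y} (x-unit : IsUnit x) → y * x ≈ 1# → recip x-unit ≈ y
  recip-unique {x} {y} (v , _ , xv≈1) yx≈1 = begin
    v           ≈⟨ *-identityˡ v ⟨
    1# * v      ≈⟨ *-congʳ yx≈1 ⟨
    y * x * v   ≈⟨ *-assoc y x v ⟩
    y * (x * v) ≈⟨ *-congˡ xv≈1 ⟩
    y * 1#      ≈⟨ *-identityʳ y ⟩
    y           ∎

  -- Multiplying the equation for V by M and using UM = 1 gives VM = U + XV. Substituting this in
  -- M(VM) - X(VM) leaves UM.
  big-inverse : ∀ {U M V X} → U * M ≈ 1# → V ≈ U * U + U * (X * V) → V * (M * (M - X)) ≈ 1#
  big-inverse {U} {M} {V} {X} UM≈1 V≈ = begin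
    V * (M * (M - X))
      -- The solver works over semirings: `- X` enters as an independent variable, and `X - X` is
      -- cancelled by hand afterwards.
      ≈⟨ Solver.solve 3 (λ V M x → V :* (M :* (M :+ x)) := M :* (V :* M) :+ x :* (V :* M)) refl V M (- X) ⟩
    M * (V * M) + - X * (V * M)
      ≈⟨ +-congʳ (*-congˡ VM≈) ⟩
    M * (U + X * V) + - X * (V * M)
      ≈⟨ Solver.solve 5 (λ U V M X x → M :* (U :+ X :* V) :+ x :* (V :* M) := U :* M :+ (X :+ x) :* (V :* M)) refl U V M X (- X) ⟩
    U * M + (X - X) * (V * M)
      ≈⟨ +-cong UM≈1 (trans (*-congʳ (-‿inverseʳ X)) (zeroˡ _)) ⟩
    1# + 0#
      ≈⟨ +-identityʳ 1# ⟩
    1# ∎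
    where
    VM≈ : V * M ≈ U + X * V
    VM≈ = begin
      V * M                     ≈⟨ *-congʳ V≈ ⟩
      (U * U + U * (X * V)) * M ≈⟨ Solver.solve 4 (λ U V M X → (U :* U :+ U :* (X :* V)) :* M := (U :* M) :* (U :+ X :* V)) refl U V M X ⟩
      (U * M) * (U + X * V)     ≈⟨ trans (*-congʳ UM≈1) (*-identityˡ _) ⟩
      U + X * V                 ∎

  -- Clearing denominators gives M(M - X) + Y(M - X) + Z.
  factor-numerator : ∀ {U M V X Y Z} → U * M ≈ 1# → V * (M * (M - X)) ≈ 1# →
    (1# + (Y * U + Z * V)) * (M * (M - X)) ≈ Z + (M - X) * (M + Y)
  factor-numerator {U} {M} {V} {X} {Y} {Z} UM≈1 Vd≈1 = begin
    (1# + (Y * U + Z * V)) * (M * (M - X))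
      ≈⟨ Solver.solve 7 (λ e U M V x Y Z → (e :+ (Y :* U :+ Z :* V)) :* (M :* (M :+ x)) :=
           (V :* (M :* (M :+ x))) :* Z :+ (M :+ x) :* (e :* M :+ (U :* M) :* Y)) refl 1# U M V (- X) Y Z ⟩
    (V * (M * (M - X))) * Z + (M - X) * (1# * M + (U * M) * Y)
      ≈⟨ +-cong (trans (*-congʳ Vd≈1) (*-identityˡ Z))
                (*-congˡ (+-cong (*-identityˡ M) (trans (*-congʳ UM≈1) (*-identityˡ Y)))) ⟩
    Z + (M - X) * (M + Y) ∎

  ∏ : (ℕ → Carrier) → ℕ → Carrier
  ∏ f zero    = 1#
  ∏ f (suc j) = f 0 * ∏ (f ∘ suc) j

  -- `∏` grows at the front, as `generating` does; `rising` grows at the back.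
  ∏-last : ∀ f j → ∏ f (suc j) ≈ ∏ f j * f j
  ∏-last f zero    = *-comm _ _
  ∏-last f (suc j) = trans (*-congˡ (∏-last (f ∘ suc) j)) (sym (*-assoc _ _ _))

  -- Terms of the hypergeometric sum

  module Hypergeometric {α β X Y Z : Carrier} (α+β≈X+Y : α + β ≈ X + Y) (αβ≈Z : α * β ≈ Z) where

    -- As a polynomial in M - X the product is αβ + (M - X)(α + β) + (M - X)², so it depends on α
    -- and β only through their sum and product.
    quadratic : ∀ M → (α - X + M) * (β - X + M) ≈ Z + (M - X) * (M + Y)
    quadratic M = begin
      (α - X + M) * (β - X + M)
        ≈⟨ Solver.solve 4 (λ α β x M → (α :+ x :+ M) :* (β :+ x :+ M) :=
             α :* β :+ (M :+ x) :* ((α :+ β) :+ (M :+ x))) refl α β (- X) M ⟩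
      α * β + (M - X) * ((α + β) + (M - X))
        ≈⟨ +-cong αβ≈Z (*-congˡ (+-congʳ α+β≈X+Y)) ⟩
      Z + (M - X) * ((X + Y) + (M - X))
        ≈⟨ +-congˡ (*-congˡ (Solver.solve 4 (λ X Y M x → (X :+ Y) :+ (M :+ x) := (M :+ Y) :+ (X :+ x)) refl X Y M (- X))) ⟩
      Z + (M - X) * ((M + Y) + (X - X))
        ≈⟨ +-congˡ (*-congˡ (trans (+-congˡ (-‿inverseʳ X)) (+-identityʳ _))) ⟩
      Z + (M - X) * (M + Y) ∎

    den : ℕ → Carrier
    den j = rising (1# - X) j * fromℕ (j !)

    -- The ratio of `den (suc j)` to `den j`.
    d : ℕ → Carrier
    d j = fromℕ (suc j) * (fromℕ (suc j) - X)

    den-suc : ∀ j → den (suc j) ≈ den j * d j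
    den-suc j = begin
      rising (1# - X) j * (1# - X + fromℕ j) * fromℕ (suc j ℕ.* j !)
        ≈⟨ *-cong (*-congˡ (+CS.xy∙z≈xz∙y 1# (- X) (fromℕ j))) (×1-homo-* (suc j) (j !)) ⟩
      rising (1# - X) j * (fromℕ (suc j) - X) * (fromℕ (suc j) * fromℕ (j !))
        ≈⟨ Solver.solve 4 (λ r e m f → r :* e :* (m :* f) := r :* f :* (m :* e)) refl
             (rising (1# - X) j) (fromℕ (suc j) - X) (fromℕ (suc j)) (fromℕ (j !)) ⟩
      den j * d j ∎
      where
      open SemiringMult semiring using (×1-homo-*)
      module +CS = CommutativeSemigroupProperties +-commutativeSemigroup

    module _ (F V : ℕ → Carrier)
             (F-numerator : ∀ j → F j * d j ≈ Z + (fromℕ (suc j) - X) * (fromℕ (suc j) + Y))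
             (V-inverse : ∀ j → V j * d j ≈ 1#) where

      -- The factor of index 0 is Z - XY. Each later pair of factors is `F j * d j` by `quadratic`,
      -- and the `d j` multiply up to the denominator. Of the `suc j` pairs only `j` enter `∏ F j`.
      rising-numerator : ∀ j →
        rising (α - X) (suc j) * rising (β - X) (suc j) ≈ (Z - X * Y) * ∏ F j * den j
      rising-numerator zero = begin
        1# * (α - X + 0#) * (1# * (β - X + 0#))
          ≈⟨ *-cong (*-identityˡ _) (*-identityˡ _) ⟩
        (α - X + 0#) * (β - X + 0#)
          ≈⟨ quadratic 0# ⟩
        Z + (0# - X) * (0# + Y)
          ≈⟨ +-congˡ (trans (*-cong (+-identityˡ _) (+-identityˡ _)) (sym (-‿distribˡ-* X Y))) ⟩
        Z - X * Y
          ≈⟨ trans (*-cong (*-identityʳ _) (trans (*-identityˡ _) (+-identityʳ 1#))) (*-identityʳ _) ⟨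
        (Z - X * Y) * 1# * (1# * (1# + 0#)) ∎
        where open RingProperties ring using (-‿distribˡ-*)
      rising-numerator (suc j) = begin
        rising (α - X) (suc j) * (α - X + fromℕ (suc j)) * (rising (β - X) (suc j) * (β - X + fromℕ (suc j)))
          ≈⟨ *CS.interchange _ _ _ _ ⟩
        rising (α - X) (suc j) * rising (β - X) (suc j) * ((α - X + fromℕ (suc j)) * (β - X + fromℕ (suc j)))
          ≈⟨ *-cong (rising-numerator j) (trans (quadratic (fromℕ (suc j))) (sym (F-numerator j))) ⟩
        (Z - X * Y) * ∏ F j * den j * (F j * d j)
          ≈⟨ Solver.solve 5 (λ D P e f d → D :* P :* e :* (f :* d) := D :* (P :* f) :* (e :* d)) refl
               (Z - X * Y) (∏ F j) (den j) (F j) (d j) ⟩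
        (Z - X * Y) * (∏ F j * F j) * (den j * d j)
          ≈⟨ *-cong (*-congˡ (∏-last F j)) (den-suc j) ⟨
        (Z - X * Y) * ∏ F (suc j) * den (suc j) ∎

      -- The numerator supplies `den j` and the denominator is `den (suc j)`, so only the inverse of
      -- `d j`, namely `V j`, survives.
      hypergeometric-term : ∀ j (den-unit : IsUnit (den (suc j))) W →
        rising (α - X) (suc j) * rising (β - X) (suc j) * recip den-unit * W ≈
        (Z - X * Y) * (∏ F j * V j * W)
      hypergeometric-term j (v , v-den , den-v) W = begin
        rising (α - X) (suc j) * rising (β - X) (suc j) * v * W
          ≈⟨ *-congʳ (*-congʳ (rising-numerator j)) ⟩
        (Z - X * Y) * ∏ F j * den j * v * W
          ≈⟨ Solver.solve 5 (λ D P e v W → D :* P :* e :* v :* W := D :* (P :* (e :* v) :* W)) refl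
               (Z - X * Y) (∏ F j) (den j) v W ⟩
        (Z - X * Y) * (∏ F j * (den j * v) * W)
          ≈⟨ *-congˡ (*-congʳ (*-congˡ den-ratio)) ⟩
        (Z - X * Y) * (∏ F j * V j * W) ∎
        where
        den-ratio : den j * v ≈ V j
        den-ratio = begin
          den j * v                 ≈⟨ *-identityʳ _ ⟨
          -- Inserting `V j * d j` turns `den j` into `den (suc j)`, which cancels against its
          -- inverse `v`.
          den j * v * 1#            ≈⟨ *-congˡ (V-inverse j) ⟨
          den j * v * (V j * d j)   ≈⟨ Solver.solve 4 (λ e v V d → e :* v :* (V :* d) := v :* (e :* d) :* V) refl (den j) v (V j) (d j) ⟩
          v * (den j * d j) * V j   ≈⟨ *-congʳ (*-congˡ (den-suc j)) ⟨
          v * den (suc j) * V j     ≈⟨ *-congʳ v-den ⟩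
          1# * V j                  ≈⟨ *-identityˡ _ ⟩
          V j                       ∎

-- Comparison of Φ₀ with the hypergeometric sum

module Proof
  {c ℓ₁ ℓ₂ s ℓₛ : Level}
  (K : HeytingField c ℓ₁ ℓ₂) (char0 : FieldNotions.CharZero K) (n : ℕ)
  (z : HeytingField.Carrier K) (z#0 : HeytingField._#_ K z (HeytingField.0# K))
  (den#0 : FieldNotions.DenominatorsNonzero K (suc n) z z#0)
  (S : CommutativeRing s ℓₛ)
  (ι : CommutativeRing.Carrier (K⟦X,Y,Z⟧ (fieldRing K)) → CommutativeRing.Carrier S)
  (ι-mono : IsMono (K⟦X,Y,Z⟧ (fieldRing K)) S ι)
  where

  private
    k = fieldRing K
    module K where
      open CommutativeRing k public
      open FieldNotions K public
      open FiniteSums k public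
      open TripleSeries k public
    module R where
      open CommutativeRing (K⟦X,Y,Z⟧ k) public
      open RingNotions (K⟦X,Y,Z⟧ k) public
      open RationalIdentities (K⟦X,Y,Z⟧ k) public
    module S where
      open CommutativeRing S public
      open RingNotions S public
      open FiniteSums S public
      open RationalIdentities S public
    module ι where
      open IsRingMonomorphism ι-mono public
      open HomProperties {A = K⟦X,Y,Z⟧ k} {B = S} isRingHomomorphism public
    module E = Extension K S ι ι-mono
    module T = Truncated K char0 n z z#0 den#0

  u : ℕ → K.Carrier
  u j = K.fromℕ (suc j) K.⁻¹[ char0 j ]

  w : Fin n → K.Carrier
  w j = T.weight (suc j)

  -- Membership in I₀ becomes the guard `hasExponents`, and the sums over exponents and over indices
  -- are interchanged, so that the recursion on the index range applies.
  Φ₀≈generating : T.Φ₀ R.≈ K.generating n u w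
  Φ₀≈generating p q s = begin
    K.∑ (I₀ k₀ r h) T.Li
      ≈⟨ K.∑-filter (isI₀? k₀ r h) kss T.Li ⟩
    K.∑ kss (λ ks → does (isI₀? k₀ r h ks) K.▸ T.Li ks)
      ≈⟨ K.∑-tuples-congAll (Allₚ.applyUpTo⁺₂ suc k₀ (λ _ → s≤s z≤n)) (suc r) (λ ks 0<ks →
           K.reflexive (≡.cong (K._▸ T.Li ks) (isI₀≡hasExponents p q s ks 0<ks ≡.refl))) ⟩
    K.∑ kss (λ ks → hasExponents ks p q s K.▸ T.Li ks)
      ≈⟨ K.∑-cong kss (λ ks → K.∑-▸ (increasing n (suc r)) (hasExponents ks p q s) _) ⟨
    K.∑ kss (λ ks → K.∑ (increasing n (suc r)) (λ js →
      hasExponents ks p q s K.▸ K.monomial u js ks K.* w (last js)))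
      ≈⟨ K.∑-swap kss (increasing n (suc r)) _ ⟩
    K.coefficient u w k₀ r p q s
      -- The weight `k₀`, which bounds the exponents, computes to the successor of `s + q + h + p`;
      -- the latter exceeds `p` because `h` is positive.
      ≈⟨ K.coefficient≈generating n u w (s ℕ.+ q ℕ.+ h ℕ.+ p) r p q s
           (ℕₚ.+-monoˡ-≤ p (ℕₚ.≤-trans (s≤s z≤n) (ℕₚ.m≤n+m h (s ℕ.+ q)))) ≡.refl ⟩
    K.generating n u w p q s ∎
    where
    open SetoidReasoning K.setoid
    h r k₀ : ℕ
    h  = suc s
    r  = s ℕ.+ q
    k₀ = suc s ℕ.+ q ℕ.+ h ℕ.+ p
    kss : List (Vec ℕ (suc r))
    kss = tuples (applyUpTo suc k₀) (suc r)

  X Y Z : S.Carrier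
  X = ι (𝐗 k)
  Y = ι (𝐘 k)
  Z = ι (𝐙 k)

  F V : ℕ → S.Carrier
  F j = ι (K.factor (u j))
  V j = ι (K.big (u j))

  UM≈1 : ∀ j → scalar k (u j) R.* R.fromℕ (suc j) R.≈ R.1#
  UM≈1 j = K.scalar-inverse (suc j) (u j) (proj₁ (proj₂ (K.#0⇒unit (char0 j))))

  big-inverse : ∀ j → K.big (u j) R.* (R.fromℕ (suc j) R.* (R.fromℕ (suc j) R.- 𝐗 k)) R.≈ R.1#
  big-inverse j = R.big-inverse (UM≈1 j) (K.big-recursive (u j))

  -- Unrolls the Horner-like recursion into one sum over the last index, the shape in which the
  -- hypergeometric terms appear.
  generating-homo : ∀ n u (w : Fin n → K.Carrier) → ι (K.generating n u w) S.≈
    S.∑ (allFin n) (λ j → S.∏ (ι ∘ K.factor ∘ u) (toℕ j) S.* ι (K.big (u (toℕ j))) S.* ι (scalar k (w j)))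
  generating-homo zero    u w = ι.0#-homo
  generating-homo (suc n) u w = begin
    ι (K.generating (suc n) u w)
      ≈⟨ S.trans (ι.+-homo _ _) (S.+-cong (ι.*-homo _ _) (ι.*-homo _ _)) ⟩
    ι (scalar k (w zero)) S.* ι (K.big (u 0)) S.+ f 0 S.* ι (K.generating n (u ∘ suc) (w ∘ suc))
      ≈⟨ S.+-cong (S.trans (S.*-comm _ _) (S.*-congʳ (S.sym (S.*-identityˡ _))))
                  (S.*-congˡ (generating-homo n (u ∘ suc) (w ∘ suc))) ⟩
    term zero S.+ f 0 S.* S.∑ (allFin n) term′
      ≈⟨ S.+-congˡ (S.∑-* (allFin n) (f 0) term′) ⟨
    term zero S.+ S.∑ (allFin n) (λ j → f 0 S.* term′ j)
      ≈⟨ S.+-congˡ (S.∑-cong (allFin n) (λ j →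
           S.trans (S.sym (S.*-assoc _ _ _)) (S.*-congʳ (S.sym (S.*-assoc _ _ _))))) ⟩
    term zero S.+ S.∑ (allFin n) (term ∘ suc)
      ≈⟨ S.reflexive (S.∑-allFin-suc n term) ⟨
    S.∑ (allFin (suc n)) term ∎
    where
    open SetoidReasoning S.setoid
    f : ℕ → S.Carrier
    f = ι ∘ K.factor ∘ u
    term : Fin (suc n) → S.Carrier
    term j = S.∏ f (toℕ j) S.* ι (K.big (u (toℕ j))) S.* ι (scalar k (w j))
    term′ : Fin n → S.Carrier
    term′ j = S.∏ (f ∘ suc) (toℕ j) S.* ι (K.big (u (suc (toℕ j)))) S.* ι (scalar k (w (suc j)))

  -- Numerator and denominator are empty products. This is for the term m = 0, the 1 that is
  -- subtracted from the hypergeometric sum.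
  weight-zero : ι (scalar k (T.weight zero)) S.≈ S.1#
  weight-zero = S.trans (ι.⟦⟧-cong (⟦⟧-cong weight≈1)) ι.1#-homo
    where
    open IsRingHomomorphism (K.scalar-isHom)
    weight≈1 : T.weight zero K.≈ K.1#
    weight≈1 = K.trans (K.*-identityˡ _)
      (RationalIdentities.recip-unique k (K.#0⇒unit (den#0 zero)) (K.*-identityˡ K.1#))

  D-homo : ι (𝐙 k R.- 𝐗 k R.* 𝐘 k) S.≈ Z S.- X S.* Y
  D-homo = S.trans (ι.+-homo _ _) (S.+-congˡ (S.trans (ι.-‿homo _) (S.-‿cong (ι.*-homo _ _))))

  module _ (α β : S.Carrier) (α+β : α S.+ β S.≈ ι (𝐗 k R.+ 𝐘 k)) (α*β : α S.* β S.≈ ι (𝐙 k)) where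
    open S.Hypergeometric {α} {β} {X} {Y} {Z} (S.trans α+β (ι.+-homo _ _)) α*β

    -- Serves to carry the identities for `big` and `factor`, proved in `K⟦X,Y,Z⟧`, over to `S`.
    d-homo : ∀ j → ι (R.fromℕ (suc j) R.* (R.fromℕ (suc j) R.- 𝐗 k)) S.≈ d j
    d-homo j = S.trans (ι.*-homo _ _) (S.*-cong (ι.fromℕ-homo (suc j))
      (S.trans (ι.+-homo _ _) (S.+-cong (ι.fromℕ-homo (suc j)) (ι.-‿homo _))))

    V-inverse : ∀ j → V j S.* d j S.≈ S.1#
    V-inverse j = begin
      V j S.* d j                                                             ≈⟨ S.*-congˡ (d-homo j) ⟨
      V j S.* ι (R.fromℕ (suc j) R.* (R.fromℕ (suc j) R.- 𝐗 k))              ≈⟨ ι.*-homo _ _ ⟨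
      ι (K.big (u j) R.* (R.fromℕ (suc j) R.* (R.fromℕ (suc j) R.- 𝐗 k)))    ≈⟨ ι.⟦⟧-cong (big-inverse j) ⟩
      ι R.1#                                                                  ≈⟨ ι.1#-homo ⟩
      S.1#                                                                    ∎
      where open SetoidReasoning S.setoid

    F-numerator : ∀ j → F j S.* d j S.≈ Z S.+ (S.fromℕ (suc j) S.- X) S.* (S.fromℕ (suc j) S.+ Y)
    F-numerator j = begin
      F j S.* d j
        ≈⟨ S.*-congˡ (d-homo j) ⟨
      F j S.* ι (R.fromℕ (suc j) R.* (R.fromℕ (suc j) R.- 𝐗 k))
        ≈⟨ ι.*-homo _ _ ⟨
      ι (K.factor (u j) R.* (R.fromℕ (suc j) R.* (R.fromℕ (suc j) R.- 𝐗 k)))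
        ≈⟨ ι.⟦⟧-cong (R.factor-numerator (UM≈1 j) (big-inverse j)) ⟩
      ι (𝐙 k R.+ (R.fromℕ (suc j) R.- 𝐗 k) R.* (R.fromℕ (suc j) R.+ 𝐘 k))
        ≈⟨ S.trans (ι.+-homo _ _) (S.+-congˡ (S.trans (ι.*-homo _ _) (S.*-cong
             (S.trans (ι.+-homo _ _) (S.+-cong (ι.fromℕ-homo (suc j)) (ι.-‿homo _)))
             (S.trans (ι.+-homo _ _) (S.+-congʳ (ι.fromℕ-homo (suc j))))))) ⟩
      Z S.+ (S.fromℕ (suc j) S.- X) S.* (S.fromℕ (suc j) S.+ Y) ∎
      where open SetoidReasoning S.setoid

    F₂₁ : S.Carrier
    F₂₁ = T.₂F₁ S (ι ∘ scalar k) (α S.- X) (β S.- X) (S.1# S.- X) (E.unit-denominator char0 ∘ toℕ)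

    -- The term m = 0 is 1, and the term m = j + 1 is Z - XY times the summand of index j in
    -- `generating-homo`.
    ₂F₁≈ : F₂₁ S.≈ S.1# S.+ ι (𝐙 k R.- 𝐗 k R.* 𝐘 k) S.* ι T.Φ₀
    ₂F₁≈ = begin
      S.∑ (allFin (suc n)) term
        ≈⟨ S.reflexive (S.∑-allFin-suc n term) ⟩
      term zero S.+ S.∑ (allFin n) (term ∘ suc)
        ≈⟨ S.+-cong term-zero (S.∑-cong (allFin n) (λ j →
             hypergeometric-term F V F-numerator V-inverse (toℕ j) (E.unit-denominator char0 (suc (toℕ j))) (ι (scalar k (w j))))) ⟩
      S.1# S.+ S.∑ (allFin n) (λ j → (Z S.- X S.* Y) S.* (S.∏ F (toℕ j) S.* V (toℕ j) S.* ι (scalar k (w j))))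
        ≈⟨ S.+-congˡ (S.∑-* (allFin n) (Z S.- X S.* Y) _) ⟩
      S.1# S.+ (Z S.- X S.* Y) S.* S.∑ (allFin n) (λ j → S.∏ F (toℕ j) S.* V (toℕ j) S.* ι (scalar k (w j)))
        ≈⟨ S.+-congˡ (S.*-cong D-homo (S.trans (ι.⟦⟧-cong Φ₀≈generating) (generating-homo n u w))) ⟨
      S.1# S.+ ι (𝐙 k R.- 𝐗 k R.* 𝐘 k) S.* ι T.Φ₀ ∎
      where
      open SetoidReasoning S.setoid
      term : Fin (suc n) → S.Carrier
      term m = S.rising (α S.- X) (toℕ m) S.* S.rising (β S.- X) (toℕ m)
             S.* S.recip (E.unit-denominator char0 (toℕ m)) S.* ι (scalar k (T.weight m))
      recip≈1 : S.recip (E.unit-denominator char0 0) S.≈ S.1#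
      recip≈1 = S.recip-unique (E.unit-denominator char0 0)
        (S.trans (S.*-identityˡ _) (S.trans (S.*-identityˡ _) (S.+-identityʳ S.1#)))
      term-zero : term zero S.≈ S.1#
      term-zero = S.trans (S.*-cong (S.trans (S.*-cong (S.*-identityˡ S.1#) recip≈1) (S.*-identityˡ S.1#)) weight-zero)
        (S.*-identityˡ S.1#)

    isExactQuotient : E.IsExactQuotient T.Φ₀ (F₂₁ S.- S.1#) (𝐙 k R.- 𝐗 k R.* 𝐘 k)
    isExactQuotient = record
      { exact  = exact
      -- Injectivity of `ι` moves the cancellation from `S`, which need not be a domain, to
      -- `K⟦X,Y,Z⟧`.
      ; unique = λ q eq → K.Z-XY-cancel q T.Φ₀ (ι.injective (begin
          ι (D R.* q)         ≈⟨ ι.*-homo _ _ ⟩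
          ι D S.* ι q         ≈⟨ eq ⟩
          F₂₁ S.- S.1#        ≈⟨ exact ⟨
          ι D S.* ι T.Φ₀      ≈⟨ ι.*-homo _ _ ⟨
          ι (D R.* T.Φ₀)      ∎))
      }
      where
      open SetoidReasoning S.setoid
      D : R.Carrier
      D = 𝐙 k R.- 𝐗 k R.* 𝐘 k
      exact : ι D S.* ι T.Φ₀ S.≈ F₂₁ S.- S.1#
      exact = begin
        ι D S.* ι T.Φ₀                     ≈⟨ xyx⁻¹≈y S.1# _ ⟨
        S.1# S.+ ι D S.* ι T.Φ₀ S.- S.1#   ≈⟨ S.+-congʳ ₂F₁≈ ⟨
        F₂₁ S.- S.1#                       ∎
        where open RingProperties S.ring using (xyx⁻¹≈y)

theorem5p2 : ∀ {c ℓ₁ ℓ₂ s ℓₛ : Level}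
    (K : HeytingField c ℓ₁ ℓ₂)
    (let module K = HeytingField K)
    (char0 : FieldNotions.CharZero K)
    (n : ℕ)
    (let N = suc n)
    (z : K.Carrier)
    (z#0 : z K.# K.0#)
    (den#0 : FieldNotions.DenominatorsNonzero K N z z#0)
    (let k = fieldRing K)
    (let module R = CommutativeRing (K⟦X,Y,Z⟧ k))
    (S : CommutativeRing s ℓₛ)
    (let module S = CommutativeRing S)
    (ι : R.Carrier → S.Carrier)
    (ι-mono : IsMono (K⟦X,Y,Z⟧ k) S ι)
    (let module E = Extension K S ι ι-mono)
    (let module T = Truncated K char0 n z z#0 den#0)
    (α β : S.Carrier) →
    α S.+ β S.≈ ι (𝐗 k R.+ 𝐘 k) →
    α S.* β S.≈ ι (𝐙 k) →
    E.IsExactQuotient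
    T.Φ₀
    (T.₂F₁ S (ι ∘ scalar k) (α S.- E.X) (β S.- E.X) (S.1# S.- E.X) (E.unit-denominator char0 ∘ toℕ) S.- S.1#)
    (𝐙 k R.- 𝐗 k R.* 𝐘 k)
theorem5p2 K char0 n z z#0 den#0 S ι ι-mono α β α+β α*β =
  Proof.isExactQuotient K char0 n z z#0 den#0 S ι ι-mono α β α+β α*β
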